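{- Let $q>1$ be any prime power, and for each positive integer $n$ let $N_n(q)$ denote the number of monic irreducible polynomials of degree $n$ over the finite field $\mathbb{F}_q$. Then: (1) the sequence $\big(\sqrt[n]{N_n(q)}\big)_{n>e^{3+7/(q-1)^2}}$ is strictly increasing, i.e. $\sqrt[n+1]{N_{n+1}(q)}>\sqrt[n]{N_n(q)}$ for every integer $n>e^{3+7/(q-1)^2}$; (2) the sequence $\big(\sqrt[n+1]{N_{n+1}(q)}/\sqrt[n]{N_n(q)}\big)_{n\geq 5.835\times 10^{14}}$ is strictly decreasing; (3) if $q\geq 9$, then the sequence $\big(N_{n+1}(q)/N_n(q)\big)_{n\geq 1}$ is strictly increasing; (4) if $q<9$, then the sequence $\big(N_{n+1}(q)/N_n(q)\big)_{n\geq 19}$ is strictly increasing.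
   Context: $\mathbb{F}_q$ denotes the finite field with $q$ elements. -}

module Defs where

open import Level using (0ℓ)
open import Data.Nat as ℕ using (ℕ; zero; suc; _∸_; _^_; _≤_; _<_)
open import Data.Nat using (_!)
open import Data.Nat.Primality using (Prime)
open import Data.Integer using (+_)
open import Data.Rational.Unnormalised as Q using (ℚᵘ; mkℚᵘ; 0ℚᵘ; 1ℚᵘ)
open import Data.Fin using (Fin)
open import Data.Vec using (Vec; toList)
open import Data.List using (List; []; _∷_; map; _++_; [_])
open import Data.Product using (Σ; ∃; _×_; _,_)
open import Relation.Binary.PropositionalEquality using (_≡_; _≢_)
open import Relation.Nullary using (¬_)
open import Function.Bundles using (_↔_)
import Algebra.Structures as AS

IsPrimePower : ℕ → Set
IsPrimePower q = Σ ℕ λ p → Σ ℕ λ k → Prime p × 1 ≤ k × q ≡ p ^ k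

record FiniteField (q : ℕ) : Set₁ where
  field
    Carrier : Set
    _+_ : Carrier → Carrier → Carrier
    _*_ : Carrier → Carrier → Carrier
    -_  : Carrier → Carrier
    0#  : Carrier
    1#  : Carrier
    isCommutativeRing : AS.IsCommutativeRing {A = Carrier} _≡_ _+_ _*_ -_ 0# 1#
    0≢1 : 0# ≢ 1#
    inverse : ∀ x → x ≢ 0# → Σ Carrier λ y → x * y ≡ 1#
    card : Fin q ↔ Carrier

-- Polynomials over a finite field, as coefficient lists
-- (constant coefficient first).

module Poly {q : ℕ} (F : FiniteField q) where
  open FiniteField F

  Pol : Set
  Pol = List Carrier

  addP : Pol → Pol → Pol
  addP []       bs       = bs
  addP (a ∷ as) []       = a ∷ as
  addP (a ∷ as) (b ∷ bs) = (a + b) ∷ addP as bs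

  mulP : Pol → Pol → Pol
  mulP []       bs = []
  mulP (a ∷ as) bs = addP (map (a *_) bs) (0# ∷ mulP as bs)

  -- A monic polynomial of degree n: x^n + c_{n-1} x^{n-1} + … + c_0,
  -- given by its n lower coefficients (c_0, …, c_{n-1}).
  Monic : ℕ → Set
  Monic n = Vec Carrier n

  toPol : ∀ {n} → Monic n → Pol
  toPol c = toList c ++ [ 1# ]

  Irreducible : ∀ {n} → Monic n → Set
  Irreducible {n} f =
    1 ≤ n ×
    ¬ (Σ ℕ λ a → Σ ℕ λ b → Σ (Monic a) λ g → Σ (Monic b) λ h →
         1 ≤ a × 1 ≤ b × toPol f ≡ mulP (toPol g) (toPol h))

  MonicIrreducible : ℕ → Set
  MonicIrreducible n = Σ (Monic n) Irreducible

CountsIrreducibles : ∀ {q} → FiniteField q → (ℕ → ℕ) → Set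
CountsIrreducibles F N = ∀ n → 1 ≤ n → Fin (N n) ↔ Poly.MonicIrreducible F n

-- Exponential comparison:  e^c < x  for a rational c ≥ 0.
--
-- expPartial c N = Σ_{j=0}^{N} c^j / j!.  For 0 ≤ c and 2c ≤ N + 2 the
-- tail Σ_{j>N} c^j/j! is at most 2 c^{N+1}/(N+1)!, and the tail bound
-- tends to 0, hence
--   e^c < x  ⇔  ∃ N. 2c ≤ N+2  and  expPartial c N + 2 c^{N+1}/(N+1)! < x.

powQ : ℚᵘ → ℕ → ℚᵘ
powQ c zero    = 1ℚᵘ
powQ c (suc k) = c Q.* powQ c k

invFact : ℕ → ℚᵘ
invFact j = mkℚᵘ (+ 1) ((j !) ∸ 1)

expPartial : ℚᵘ → ℕ → ℚᵘ
expPartial c zero    = 1ℚᵘ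
expPartial c (suc N) = expPartial c N Q.+ (powQ c (suc N) Q.* invFact (suc N))

ℕtoℚ : ℕ → ℚᵘ
ℕtoℚ n = mkℚᵘ (+ n) 0

ExpLess : ℚᵘ → ℚᵘ → Set
ExpLess c x = Σ ℕ λ N →
  ((ℕtoℚ 2 Q.* c) Q.≤ ℕtoℚ (suc (suc N))) ×
  ((expPartial c N Q.+ (ℕtoℚ 2 Q.* (powQ c (suc N) Q.* invFact (suc N)))) Q.< x)

-- The exponent 3 + 7/(q-1)^2 (for q ≥ 2), as the fraction (3d+7)/d, d=(q-1)^2.
threshold : ℕ → ℚᵘ
threshold q = mkℚᵘ (+ (3 ℕ.* d ℕ.+ 7)) (d ∸ 1)
  where d = (q ∸ 1) ^ 2

{-# OPTIONS --safe #-}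
module Submission where

-- Write n = Σ d over the pairs (P, k) with P irreducible of degree d, k ≥ 1 and P^k ∣ f, for each monic f
-- of degree n.  Exactly q^(n−kd) of the q^n polynomials f are divisible by P^k, so summing over f gives
-- n q^n = Σ d N_d q^(n−kd), and comparing n + 1 with n leaves Gauss's formula q^n = Σ_{d ∣ n} d N_d.
-- Hence q^n − 2 q^⌊n/2⌋ ≤ n N_n ≤ q^n, and each part follows by replacing n N_n with q^n:
-- the relative error 2 q^−⌈n/2⌉ is beaten by n(n+2) < (n+1)² in (3) and (4), and for (1) and (2)
-- (1 + 1/n)^(n+1) ≤ 4 reduces the claims to 8 < n + 1 and 128 < (n + 1)².

open import Defs
open import Level using (0ℓ)
open import Algebra.Bundles using (CommutativeRing; CommutativeSemigroup)
import Algebra.Properties.AbelianGroup as AbelianGroupProperties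
import Algebra.Properties.CommutativeSemigroup as CommutativeSemigroupProperties
import Algebra.Properties.Ring as RingProperties
import Algebra.Solver.Ring.NaturalCoefficients.Default as Solver
open import Data.Bool using (if_then_else_)
import Data.Fin.Properties as Finₚ
import Data.Integer as ℤ
import Data.Integer.Properties as ℤₚ
open import Data.List using (List; []; _∷_; map; _++_; [_]; length; upTo; filter; allFin; cartesianProductWith)
open import Data.List.Membership.Propositional using (_∈_)
open import Data.List.Membership.Propositional.Properties
  using (∈-upTo⁺; ∈-upTo⁻; ∈-map⁺; ∈-map⁻; ∈-filter⁺; ∈-filter⁻; ∈-allFin; ∈-cartesianProductWith⁺)
open import Data.List.Membership.Propositional.Properties.WithK using (unique∧set⇒bag)
open import Data.List.Properties using (upTo-∷ʳ; length-map; length-++; length-tabulate)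
open import Data.List.Relation.Binary.BagAndSetEquality using (∼bag⇒↭)
open import Data.List.Relation.Binary.Permutation.Propositional.Properties using (↭-length)
open import Data.List.Relation.Unary.All as All using ([])
open import Data.List.Relation.Unary.AllPairs using ([]; _∷_)
open import Data.List.Relation.Unary.Any using (here; there)
open import Data.List.Relation.Unary.Unique.Propositional using (Unique)
import Data.List.Relation.Unary.Unique.Propositional.Properties as Uniqueₚ
open import Data.Nat as ℕ
  using (ℕ; zero; suc; _≤_; _<_; z≤n; s≤s; _+_; _*_; _^_; _∸_; _⊓_; NonZero; >-nonZero)
open import Data.Nat.Divisibility using (divides; ∣-refl) renaming (_∣_ to _∣ℕ_; _∣?_ to _∣ℕ?_)
import Data.Nat.Properties as ℕₚ
open import Data.Nat.Tactic.RingSolver using (solve-∀)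
open import Data.Product using (∃; ∃₂; _×_; _,_; proj₁; proj₂)
open import Data.Rational.Unnormalised as ℚ using (*≤*; *<*)
import Data.Rational.Unnormalised.Properties as ℚₚ
open import Data.Sum using (_⊎_; inj₁; inj₂; [_,_]′)
open import Data.Vec using ([]; _∷_)
open import Data.Vec.Properties using (∷-injective)
open import Function using (_∘_)
open import Function.Bundles using (mk⇔; module Inverse)
open import Function.Properties.Inverse using (Inverse⇒Injection; ↔-sym)
open import Relation.Binary.Definitions using (tri<; tri≈; tri>; DecidableEquality)
open import Relation.Binary.PropositionalEquality
  using (_≡_; _≢_; refl; sym; trans; cong; cong₂; subst; subst₂; module ≡-Reasoning)
open import Relation.Nullary using (¬_; Dec; yes; no; does; contradiction)
open import Relation.Nullary.Decidable using (dec-true; dec-false; decidable-stable; toWitness; via-injection)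

-- Finite sums

-- Multiplicities are recorded by the divisibilities P^k ∣ f and not by a factorisation, so unique
-- factorisation is never stated: Euclid's lemma and cancellation show that passing from g to g P
-- adds one divisibility for P and changes none for another prime, and induction on the degree does
-- the rest. `Irreducible` is a negated existence statement, so an irreducible factor is obtained
-- only under a double negation. This suffices because it serves to prove an equation between
-- natural numbers, which is stable. The formulas for n and n + 1 are compared summand by summand,
-- so degrees and exponents both run up to a common bound M, whatever the degree of f. All estimates
-- stay in ℕ: roots and quotients are cleared, and so are the denominators in Bernoulli's
-- inequality. General bounds fail for small n. Where q ≥ 9 and n ≤ 2 in (3), the exact values of
-- N_1, ..., N_4 are used; the pairs q = 2 and n = 19, 20 in (4) use the actual divisors. The
-- exponential enters through 1 + 3 + 9/2 + 27/6 = 13, which gives e^c > 13 for c ≥ 3.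

𝟙 : {P : Set} → Dec P → ℕ
𝟙 P? = if does P? then 1 else 0

𝟙-yes : {P : Set} (P? : Dec P) → P → 𝟙 P? ≡ 1
𝟙-yes P? p = cong (if_then 1 else 0) (dec-true P? p)

𝟙-no : {P : Set} (P? : Dec P) → ¬ P → 𝟙 P? ≡ 0
𝟙-no P? ¬p = cong (if_then 1 else 0) (dec-false P? ¬p)

𝟙-cong : {P Q : Set} (P? : Dec P) (Q? : Dec Q) → (P → Q) → (Q → P) → 𝟙 P? ≡ 𝟙 Q?
𝟙-cong (yes p) Q? P⇒Q Q⇒P = sym (𝟙-yes Q? (P⇒Q p))
𝟙-cong (no ¬p) Q? P⇒Q Q⇒P = sym (𝟙-no Q? (¬p ∘ Q⇒P))

∑ : {A : Set} → List A → (A → ℕ) → ℕ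
∑ []       f = 0
∑ (x ∷ xs) f = f x + ∑ xs f

module _ {A : Set} where

  ∑-cong : ∀ (xs : List A) {f g} → (∀ {x} → x ∈ xs → f x ≡ g x) → ∑ xs f ≡ ∑ xs g
  ∑-cong []       e = refl
  ∑-cong (x ∷ xs) e = cong₂ _+_ (e (here refl)) (∑-cong xs (e ∘ there))

  ∑-mono : ∀ (xs : List A) {f g} → (∀ {x} → x ∈ xs → f x ≤ g x) → ∑ xs f ≤ ∑ xs g
  ∑-mono []       e = z≤n
  ∑-mono (x ∷ xs) e = ℕₚ.+-mono-≤ (e (here refl)) (∑-mono xs (e ∘ there))

  ∑-+ : ∀ (xs : List A) f g → ∑ xs (λ x → f x + g x) ≡ ∑ xs f + ∑ xs g
  ∑-+ []       f g = refl
  ∑-+ (x ∷ xs) f g = trans (cong (f x + g x +_) (∑-+ xs f g)) (lemma (f x) (g x) (∑ xs f) (∑ xs g))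
    where
    lemma : ∀ a b c d → a + b + (c + d) ≡ a + c + (b + d)
    lemma = solve-∀

  ∑-* : ∀ c (xs : List A) f → ∑ xs (λ x → c * f x) ≡ c * ∑ xs f
  ∑-* c []       f = sym (ℕₚ.*-zeroʳ c)
  ∑-* c (x ∷ xs) f = trans (cong (c * f x +_) (∑-* c xs f)) (sym (ℕₚ.*-distribˡ-+ c (f x) (∑ xs f)))

  ∑-const : ∀ (xs : List A) c → ∑ xs (λ _ → c) ≡ length xs * c
  ∑-const []       c = refl
  ∑-const (x ∷ xs) c = cong (c +_) (∑-const xs c)

  ∑-zero : ∀ (xs : List A) {f} → (∀ {x} → x ∈ xs → f x ≡ 0) → ∑ xs f ≡ 0
  ∑-zero xs e = trans (∑-cong xs e) (trans (∑-const xs 0) (ℕₚ.*-zeroʳ (length xs)))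

  ∑-++ : ∀ (xs ys : List A) f → ∑ (xs ++ ys) f ≡ ∑ xs f + ∑ ys f
  ∑-++ []       ys f = refl
  ∑-++ (x ∷ xs) ys f = trans (cong (f x +_) (∑-++ xs ys f)) (sym (ℕₚ.+-assoc (f x) _ _))

  ∑-filter : ∀ {P : A → Set} (P? : ∀ x → Dec (P x)) xs → ∑ xs (𝟙 ∘ P?) ≡ length (filter P? xs)
  ∑-filter P? []       = refl
  ∑-filter P? (x ∷ xs) with P? x
  ... | yes _ = cong suc (∑-filter P? xs)
  ... | no  _ = ∑-filter P? xs

  -- Multiplying g by P alters a single summand of the weight, the one belonging to P. Uniqueness of
  -- the list ensures that this summand occurs once.
  ∑-update : ∀ {xs : List A} {x₀ f g} c → Unique xs → x₀ ∈ xs → f x₀ ≡ c + g x₀ →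
    (∀ {x} → x ∈ xs → x ≢ x₀ → f x ≡ g x) → ∑ xs f ≡ c + ∑ xs g
  ∑-update {x ∷ xs} {f = f} {g} c (x∉ ∷ u) (here refl) e same =
    trans (cong₂ _+_ e (∑-cong xs λ y∈ → same (there y∈) λ { refl → All.lookup x∉ y∈ refl }))
      (ℕₚ.+-assoc c (g x) (∑ xs g))
  ∑-update {x ∷ xs} {x₀} {f} {g} c (x∉ ∷ u) (there x₀∈) e same =
    trans (cong₂ _+_ (same (here refl) λ { refl → All.lookup x∉ x₀∈ refl })
        (∑-update {f = f} c u x₀∈ e (same ∘ there)))
      (lemma (g x) c (∑ xs g))
    where
    lemma : ∀ a c s → a + (c + s) ≡ c + (a + s)
    lemma = solve-∀

∑-swap : ∀ {A B : Set} (xs : List A) (ys : List B) (f : A → B → ℕ) →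
  ∑ xs (λ x → ∑ ys (f x)) ≡ ∑ ys (λ y → ∑ xs (λ x → f x y))
∑-swap []       ys f = sym (∑-zero ys λ _ → refl)
∑-swap (x ∷ xs) ys f = trans (cong (∑ ys (f x) +_) (∑-swap xs ys f))
  (sym (∑-+ ys (f x) (λ y → ∑ xs λ x → f x y)))

∑-upTo-suc : ∀ n f → ∑ (upTo (suc n)) f ≡ ∑ (upTo n) f + f n
∑-upTo-suc n f = trans (cong (λ xs → ∑ xs f) (sym (upTo-∷ʳ n)))
  (trans (∑-++ (upTo n) [ n ] f) (cong (∑ (upTo n) f +_) (ℕₚ.+-identityʳ (f n))))

-- Both sides are f 0 + ... + f n, split at the last and at the first term. `localWeight-same` uses
-- this to shift exponents by one.
∑-upTo-shift : ∀ n f → ∑ (upTo n) f + f n ≡ f 0 + ∑ (upTo n) (f ∘ suc)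
∑-upTo-shift zero    f = ℕₚ.+-comm 0 (f 0)
∑-upTo-shift (suc n) f = begin
  ∑ (upTo (suc n)) f + f (suc n)                  ≡⟨ cong (_+ f (suc n)) (∑-upTo-suc n f) ⟩
  ∑ (upTo n) f + f n + f (suc n)                  ≡⟨ cong (_+ f (suc n)) (∑-upTo-shift n f) ⟩
  f 0 + ∑ (upTo n) (f ∘ suc) + f (suc n)          ≡⟨ ℕₚ.+-assoc (f 0) _ _ ⟩
  f 0 + (∑ (upTo n) (f ∘ suc) + f (suc n))        ≡⟨ cong (f 0 +_) (∑-upTo-suc n (f ∘ suc)) ⟨
  f 0 + ∑ (upTo (suc n)) (f ∘ suc)                ∎
  where open ≡-Reasoning

-- A divisor d has exactly one cofactor, and the cofactor of a divisor of m + 1 lies within the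
-- range. This is how the condition d ∣ n + 1 of Gauss's formula arises from the exponents k with k
-- d = n + 1.
∑-codivisor : ∀ m i → ∑ (upTo (suc m)) (λ j → 𝟙 (suc j * suc i ℕ.≟ suc m)) ≡ 𝟙 (suc i ∣ℕ? suc m)
∑-codivisor m i = by-cases (suc i ∣ℕ? suc m)
  where
  by-cases : Dec (suc i ∣ℕ suc m) →
    ∑ (upTo (suc m)) (λ j → 𝟙 (suc j * suc i ℕ.≟ suc m)) ≡ 𝟙 (suc i ∣ℕ? suc m)
  by-cases (no i∤m) = trans
    (∑-zero (upTo (suc m)) λ {j} _ → 𝟙-no (suc j * suc i ℕ.≟ suc m) (λ e → i∤m (divides (suc j) (sym e))))
    (sym (𝟙-no (suc i ∣ℕ? suc m) i∤m))
  by-cases (yes i∣m@(divides (suc j₀) e)) = trans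
    (∑-update {f = λ j → 𝟙 (suc j * suc i ℕ.≟ suc m)} {g = λ _ → 0} 1 (Uniqueₚ.upTo⁺ (suc m))
      (∈-upTo⁺ (ℕₚ.≤-trans (ℕₚ.m≤m*n (suc j₀) (suc i)) (ℕₚ.≤-reflexive (sym e))))
      (𝟙-yes (suc j₀ * suc i ℕ.≟ suc m) (sym e))
      (λ {j} _ j≢j₀ → 𝟙-no (suc j * suc i ℕ.≟ suc m) λ e′ →
        j≢j₀ (ℕₚ.suc-injective (ℕₚ.*-cancelʳ-≡ (suc j) (suc j₀) (suc i) (trans e′ e)))))
    (trans (cong suc (∑-zero (upTo (suc m)) λ _ → refl)) (sym (𝟙-yes (suc i ∣ℕ? suc m) i∣m)))

-- The polynomial ring

module Polynomials {q : ℕ} (F : FiniteField q) where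

  open FiniteField F renaming (_+_ to _+ᶠ_; _*_ to _*ᶠ_; -_ to -ᶠ_)
  open Poly F renaming (addP to infixl 6 _⊕_; mulP to infixl 7 _⊗_)

  𝔽 : CommutativeRing 0ℓ 0ℓ
  𝔽 = record { isCommutativeRing = isCommutativeRing }

  module K where
    open CommutativeRing 𝔽 public
    open RingProperties ring public

  coef : Pol → ℕ → Carrier
  coef []      _       = 0#
  coef (a ∷ f) zero    = a
  coef (a ∷ f) (suc i) = coef f i

  -- Coefficient lists are identified up to trailing zeros.
  infix 4 _≈_
  record _≈_ (f g : Pol) : Set where
    constructor mk≈
    field at : ∀ i → coef f i ≡ coef g i
  open _≈_ public

  ≈-refl : ∀ {f} → f ≈ f
  ≈-refl .at i = refl

  ≈-reflexive : ∀ {f g} → f ≡ g → f ≈ g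
  ≈-reflexive refl = ≈-refl

  ≈-sym : ∀ {f g} → f ≈ g → g ≈ f
  ≈-sym e .at i = sym (at e i)

  ≈-trans : ∀ {f g h} → f ≈ g → g ≈ h → f ≈ h
  ≈-trans e e′ .at i = trans (at e i) (at e′ i)

  scale : Carrier → Pol → Pol
  scale a = map (a *ᶠ_)

  shift : Pol → Pol
  shift f = 0# ∷ f

  neg : Pol → Pol
  neg = map -ᶠ_

  coef-⊕ : ∀ f g i → coef (f ⊕ g) i ≡ coef f i +ᶠ coef g i
  coef-⊕ []      g       i       = sym (K.+-identityˡ _)
  coef-⊕ (a ∷ f) []      i       = sym (K.+-identityʳ _)
  coef-⊕ (a ∷ f) (b ∷ g) zero    = refl
  coef-⊕ (a ∷ f) (b ∷ g) (suc i) = coef-⊕ f g i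

  coef-scale : ∀ a f i → coef (scale a f) i ≡ a *ᶠ coef f i
  coef-scale a []      i       = sym (K.zeroʳ a)
  coef-scale a (b ∷ f) zero    = refl
  coef-scale a (b ∷ f) (suc i) = coef-scale a f i

  coef-neg : ∀ f i → coef (neg f) i ≡ -ᶠ coef f i
  coef-neg []      i       = sym K.-0#≈0#
  coef-neg (b ∷ f) zero    = refl
  coef-neg (b ∷ f) (suc i) = coef-neg f i

  ⊕-cong : ∀ {f f′ g g′} → f ≈ f′ → g ≈ g′ → f ⊕ g ≈ f′ ⊕ g′
  ⊕-cong {f} {f′} {g} {g′} e e′ .at i =
    trans (coef-⊕ f g i) (trans (cong₂ _+ᶠ_ (at e i) (at e′ i)) (sym (coef-⊕ f′ g′ i)))

  ⊕-congˡ : ∀ f {g h} → g ≈ h → f ⊕ g ≈ f ⊕ h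
  ⊕-congˡ f = ⊕-cong {f} ≈-refl

  ⊕-congʳ : ∀ f {g h} → g ≈ h → g ⊕ f ≈ h ⊕ f
  ⊕-congʳ f e = ⊕-cong {g = f} e ≈-refl

  ⊕-assoc : ∀ f g h → (f ⊕ g) ⊕ h ≈ f ⊕ (g ⊕ h)
  ⊕-assoc f g h .at i = begin
    coef ((f ⊕ g) ⊕ h) i                  ≡⟨ coef-⊕ (f ⊕ g) h i ⟩
    coef (f ⊕ g) i +ᶠ coef h i            ≡⟨ cong (_+ᶠ _) (coef-⊕ f g i) ⟩
    (coef f i +ᶠ coef g i) +ᶠ coef h i    ≡⟨ K.+-assoc _ _ _ ⟩
    coef f i +ᶠ (coef g i +ᶠ coef h i)    ≡⟨ cong (_ +ᶠ_) (coef-⊕ g h i) ⟨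
    coef f i +ᶠ coef (g ⊕ h) i            ≡⟨ coef-⊕ f (g ⊕ h) i ⟨
    coef (f ⊕ (g ⊕ h)) i                  ∎
    where open ≡-Reasoning

  ⊕-comm : ∀ f g → f ⊕ g ≈ g ⊕ f
  ⊕-comm f g .at i = trans (coef-⊕ f g i) (trans (K.+-comm _ _) (sym (coef-⊕ g f i)))

  ⊕-identityʳ : ∀ f → f ⊕ [] ≈ f
  ⊕-identityʳ f .at i = trans (coef-⊕ f [] i) (K.+-identityʳ _)

  neg-cong : ∀ {f g} → f ≈ g → neg f ≈ neg g
  neg-cong {f} {g} e .at i = trans (coef-neg f i) (trans (cong -ᶠ_ (at e i)) (sym (coef-neg g i)))

  ⊕-inverseʳ : ∀ f → f ⊕ neg f ≈ []
  ⊕-inverseʳ f .at i =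
    trans (coef-⊕ f (neg f) i) (trans (cong (coef f i +ᶠ_) (coef-neg f i)) (K.-‿inverseʳ _))

  ⊕-commutativeSemigroup : CommutativeSemigroup 0ℓ 0ℓ
  ⊕-commutativeSemigroup = record
    { _≈_ = _≈_ ; _∙_ = _⊕_
    ; isCommutativeSemigroup = record
      { isSemigroup = record
        { isMagma = record
          { isEquivalence = record { refl = ≈-refl ; sym = ≈-sym ; trans = ≈-trans }
          ; ∙-cong = ⊕-cong }
        ; assoc = ⊕-assoc }
      ; comm = ⊕-comm } }

  open CommutativeSemigroupProperties ⊕-commutativeSemigroup
    using (interchange; x∙yz≈y∙xz)
  open import Relation.Binary.Reasoning.Setoid (CommutativeSemigroup.setoid ⊕-commutativeSemigroup)

  ∷-cong : ∀ {a b f g} → a ≡ b → f ≈ g → a ∷ f ≈ b ∷ g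
  ∷-cong a≡b e .at zero    = a≡b
  ∷-cong a≡b e .at (suc i) = at e i

  shift-[] : shift [] ≈ []
  shift-[] .at zero    = refl
  shift-[] .at (suc i) = refl

  shift-⊕ : ∀ f g → shift (f ⊕ g) ≈ shift f ⊕ shift g
  shift-⊕ f g = ∷-cong (sym (K.+-identityʳ 0#)) ≈-refl

  scale-cong : ∀ a {f g} → f ≈ g → scale a f ≈ scale a g
  scale-cong a {f} {g} e .at i =
    trans (coef-scale a f i) (trans (cong (a *ᶠ_) (at e i)) (sym (coef-scale a g i)))

  scale-⊕ : ∀ a f g → scale a (f ⊕ g) ≈ scale a f ⊕ scale a g
  scale-⊕ a []      g       = ≈-refl
  scale-⊕ a (b ∷ f) []      = ≈-refl
  scale-⊕ a (b ∷ f) (c ∷ g) = ∷-cong (K.distribˡ a b c) (scale-⊕ a f g)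

  scale-shift : ∀ a f → scale a (shift f) ≈ shift (scale a f)
  scale-shift a f = ∷-cong (K.zeroʳ a) ≈-refl

  ⊗-congˡ : ∀ f {g h} → g ≈ h → f ⊗ g ≈ f ⊗ h
  ⊗-congˡ []      e = ≈-refl
  ⊗-congˡ (a ∷ f) e = ⊕-cong (scale-cong a e) (∷-cong refl (⊗-congˡ f e))

  ⊗-zeroʳ : ∀ f → f ⊗ [] ≈ []
  ⊗-zeroʳ []      = ≈-refl
  ⊗-zeroʳ (a ∷ f) = ≈-trans (∷-cong refl (⊗-zeroʳ f)) shift-[]

  -- `mulP` recurses on its left factor; this is the matching recursion on the right factor, from
  -- which commutativity follows.
  ⊗-∷ : ∀ f b g → f ⊗ (b ∷ g) ≈ scale b f ⊕ shift (f ⊗ g)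
  ⊗-∷ []      b g = ≈-sym shift-[]
  ⊗-∷ (a ∷ f) b g = ∷-cong (cong (_+ᶠ 0#) (K.*-comm a b)) (begin
    scale a g ⊕ f ⊗ (b ∷ g)                    ≈⟨ ⊕-congˡ (scale a g) (⊗-∷ f b g) ⟩
    scale a g ⊕ (scale b f ⊕ shift (f ⊗ g))    ≈⟨ x∙yz≈y∙xz (scale a g) (scale b f) _ ⟩
    scale b f ⊕ (scale a g ⊕ shift (f ⊗ g))    ∎)

  ⊗-comm : ∀ f g → f ⊗ g ≈ g ⊗ f
  ⊗-comm []      g = ≈-sym (⊗-zeroʳ g)
  ⊗-comm (a ∷ f) g = begin
    scale a g ⊕ shift (f ⊗ g)    ≈⟨ ⊕-congˡ (scale a g) (∷-cong refl (⊗-comm f g)) ⟩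
    scale a g ⊕ shift (g ⊗ f)    ≈⟨ ⊗-∷ g a f ⟨
    g ⊗ (a ∷ f)                  ∎

  ⊗-distribˡ : ∀ f g h → f ⊗ (g ⊕ h) ≈ f ⊗ g ⊕ f ⊗ h
  ⊗-distribˡ []      g h = ≈-refl
  ⊗-distribˡ (a ∷ f) g h = begin
    scale a (g ⊕ h) ⊕ shift (f ⊗ (g ⊕ h))
      ≈⟨ ⊕-cong (scale-⊕ a g h) (≈-trans (∷-cong refl (⊗-distribˡ f g h)) (shift-⊕ (f ⊗ g) (f ⊗ h))) ⟩
    (scale a g ⊕ scale a h) ⊕ (shift (f ⊗ g) ⊕ shift (f ⊗ h))
      ≈⟨ interchange (scale a g) (scale a h) (shift (f ⊗ g)) (shift (f ⊗ h)) ⟩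
    (scale a g ⊕ shift (f ⊗ g)) ⊕ (scale a h ⊕ shift (f ⊗ h)) ∎

  ⊗-distribʳ : ∀ f g h → (g ⊕ h) ⊗ f ≈ g ⊗ f ⊕ h ⊗ f
  ⊗-distribʳ f g h = begin
    (g ⊕ h) ⊗ f      ≈⟨ ⊗-comm (g ⊕ h) f ⟩
    f ⊗ (g ⊕ h)      ≈⟨ ⊗-distribˡ f g h ⟩
    f ⊗ g ⊕ f ⊗ h    ≈⟨ ⊕-cong (⊗-comm f g) (⊗-comm f h) ⟩
    g ⊗ f ⊕ h ⊗ f    ∎

  scale-⊗ : ∀ a f g → scale a f ⊗ g ≈ scale a (f ⊗ g)
  scale-⊗ a []      g = ≈-refl
  scale-⊗ a (b ∷ f) g = begin
    scale (a *ᶠ b) g ⊕ shift (scale a f ⊗ g)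
      ≈⟨ ⊕-cong (scale-scale a b g) (≈-trans (∷-cong refl (scale-⊗ a f g)) (≈-sym (scale-shift a (f ⊗ g)))) ⟩
    scale a (scale b g) ⊕ scale a (shift (f ⊗ g))
      ≈⟨ scale-⊕ a (scale b g) (shift (f ⊗ g)) ⟨
    scale a (scale b g ⊕ shift (f ⊗ g)) ∎
    where
    scale-scale : ∀ a b f → scale (a *ᶠ b) f ≈ scale a (scale b f)
    scale-scale a b []      = ≈-refl
    scale-scale a b (c ∷ f) = ∷-cong (K.*-assoc a b c) (scale-scale a b f)

  shift-⊗ : ∀ f g → shift f ⊗ g ≈ shift (f ⊗ g)
  shift-⊗ f g .at i = trans (coef-⊕ (scale 0# g) (shift (f ⊗ g)) i)
    (trans (cong (_+ᶠ coef (shift (f ⊗ g)) i) (trans (coef-scale 0# g i) (K.zeroˡ _))) (K.+-identityˡ _))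

  ⊗-assoc : ∀ f g h → (f ⊗ g) ⊗ h ≈ f ⊗ (g ⊗ h)
  ⊗-assoc []      g h = ≈-refl
  ⊗-assoc (a ∷ f) g h = begin
    (scale a g ⊕ shift (f ⊗ g)) ⊗ h          ≈⟨ ⊗-distribʳ h (scale a g) (shift (f ⊗ g)) ⟩
    scale a g ⊗ h ⊕ shift (f ⊗ g) ⊗ h        ≈⟨ ⊕-cong (scale-⊗ a g h) (shift-⊗ (f ⊗ g) h) ⟩
    scale a (g ⊗ h) ⊕ shift ((f ⊗ g) ⊗ h)    ≈⟨ ⊕-congˡ (scale a (g ⊗ h)) (∷-cong refl (⊗-assoc f g h)) ⟩
    scale a (g ⊗ h) ⊕ shift (f ⊗ (g ⊗ h))    ∎

  coef-const : ∀ c f i → coef ([ c ] ⊗ f) i ≡ c *ᶠ coef f i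
  coef-const c f i = trans (coef-⊕ (scale c f) (shift []) i)
    (trans (cong₂ _+ᶠ_ (coef-scale c f i) (at shift-[] i)) (K.+-identityʳ _))

  ⊗-identityˡ : ∀ f → [ 1# ] ⊗ f ≈ f
  ⊗-identityˡ f .at i = trans (coef-const 1# f i) (K.*-identityˡ _)

  -- Equal left factors may be lists of different lengths, on which the recursion of `mulP` does not
  -- run in parallel. Commutativity moves the change to the right factor.
  ⊗-cong : ∀ {f f′ g g′} → f ≈ f′ → g ≈ g′ → f ⊗ g ≈ f′ ⊗ g′
  ⊗-cong {f} {f′} {g} {g′} e e′ = begin
    f ⊗ g      ≈⟨ ⊗-congˡ f e′ ⟩
    f ⊗ g′     ≈⟨ ⊗-comm f g′ ⟩
    g′ ⊗ f     ≈⟨ ⊗-congˡ g′ e ⟩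
    g′ ⊗ f′    ≈⟨ ⊗-comm g′ f′ ⟩
    f′ ⊗ g′    ∎

  ⊗-congʳ : ∀ f {g h} → g ≈ h → g ⊗ f ≈ h ⊗ f
  ⊗-congʳ f e = ⊗-cong {g = f} e ≈-refl

  𝔽[x] : CommutativeRing 0ℓ 0ℓ
  𝔽[x] = record
    { Carrier = Pol ; _≈_ = _≈_ ; _+_ = _⊕_ ; _*_ = _⊗_ ; -_ = neg ; 0# = [] ; 1# = [ 1# ]
    ; isCommutativeRing = record
      { isRing = record
        { +-isAbelianGroup = record
          { isGroup = record
            { isMonoid = record
              { isSemigroup = CommutativeSemigroup.isSemigroup ⊕-commutativeSemigroup
              ; identity = (λ f → ≈-refl) , ⊕-identityʳ }
            ; inverse = (λ f → ≈-trans (⊕-comm (neg f) f) (⊕-inverseʳ f)) , ⊕-inverseʳ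
            ; ⁻¹-cong = neg-cong }
          ; comm = ⊕-comm }
        ; *-cong = ⊗-cong
        ; *-assoc = ⊗-assoc
        ; *-identity = ⊗-identityˡ , (λ f → ≈-trans (⊗-comm f [ 1# ]) (⊗-identityˡ f))
        ; distrib = ⊗-distribˡ , ⊗-distribʳ }
      ; *-comm = ⊗-comm } }

-- Division, Euclid's lemma and divisibility by prime powers

module PolynomialDivisibility {q : ℕ} (F : FiniteField q) where

  open FiniteField F renaming (_+_ to _+ᶠ_; _*_ to _*ᶠ_; -_ to -ᶠ_)
  open Poly F renaming (addP to infixl 6 _⊕_; mulP to infixl 7 _⊗_)
  open Polynomials F
  module R where
    open CommutativeRing 𝔽[x] public
    open AbelianGroupProperties +-abelianGroup public
    open RingProperties ring public using (-‿distribˡ-*)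
  open import Relation.Binary.Reasoning.Setoid R.setoid
  open Solver R.commutativeSemiring using (solve; _:+_; _:*_; _:=_; con)

  _≟ᶠ_ : DecidableEquality Carrier
  _≟ᶠ_ = via-injection (Inverse⇒Injection (↔-sym card)) Finₚ._≟_

  -- This is deg f < m with the zero polynomial included. Bounds replace a degree function, which
  -- would first have to strip trailing zeros.
  Vanish : ℕ → Pol → Set
  Vanish m f = ∀ i → m ≤ i → coef f i ≡ 0#

  record Mon (n : ℕ) (f : Pol) : Set where
    constructor mkMon
    field
      lead : coef f n ≡ 1#
      high : Vanish (suc n) f
  open Mon

  Vanish-0 : ∀ f → Vanish 0 f → f ≈ []
  Vanish-0 f v .at i = v i z≤n

  Vanish-tail : ∀ {m a f} → Vanish (suc m) (a ∷ f) → Vanish m f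
  Vanish-tail v i m≤i = v (suc i) (s≤s m≤i)

  Vanish-∷ : ∀ {m a f} → Vanish m f → Vanish (suc m) (a ∷ f)
  Vanish-∷ v (suc i) (s≤s m≤i) = v i m≤i

  Vanish-⊕ : ∀ {m} f g → Vanish m f → Vanish m g → Vanish m (f ⊕ g)
  Vanish-⊕ f g v w i m≤i = trans (coef-⊕ f g i) (trans (cong₂ _+ᶠ_ (v i m≤i) (w i m≤i)) (K.+-identityʳ 0#))

  Vanish-const : ∀ {m} c f → Vanish m f → Vanish m ([ c ] ⊗ f)
  Vanish-const c f v i m≤i = trans (coef-const c f i) (trans (cong (c *ᶠ_) (v i m≤i)) (K.zeroʳ c))

  Vanish-cong : ∀ {m f g} → f ≈ g → Vanish m f → Vanish m g
  Vanish-cong e v i m≤i = trans (sym (at e i)) (v i m≤i)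

  Mon-cong : ∀ {n f g} → f ≈ g → Mon n f → Mon n g
  Mon-cong {n} e m = mkMon (trans (sym (at e n)) (lead m)) (Vanish-cong e (high m))

  Vanish-pred : ∀ {m} f → Vanish (suc m) f → coef f m ≡ 0# → Vanish m f
  Vanish-pred {m} f v z i m≤i with ℕₚ.m≤n⇒m<n∨m≡n m≤i
  ... | inj₁ m<i  = v i m<i
  ... | inj₂ refl = z

  coef-⊗-lead : ∀ a b f g → Vanish (suc a) f → Vanish (suc b) g →
    coef (f ⊗ g) (a ℕ.+ b) ≡ coef f a *ᶠ coef g b
  Vanish-⊗ : ∀ a b f g → Vanish (suc a) f → Vanish (suc b) g → Vanish (suc (a ℕ.+ b)) (f ⊗ g)

  coef-⊗-lead a b [] g v w = sym (K.zeroˡ _)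
  coef-⊗-lead zero b (x ∷ f) g v w =
    trans (at (⊗-congʳ g (∷-cong {x} refl (Vanish-0 f (Vanish-tail v)))) b) (coef-const x g b)
  coef-⊗-lead (suc a) b (x ∷ f) g v w =
    trans (coef-⊕ (scale x g) (shift (f ⊗ g)) (suc a ℕ.+ b))
    (trans (cong₂ _+ᶠ_
        (trans (coef-scale x g (suc a ℕ.+ b)) (trans (cong (x *ᶠ_) (w _ (s≤s (ℕₚ.m≤n+m b a)))) (K.zeroʳ x)))
        (coef-⊗-lead a b f g (Vanish-tail v) w))
      (K.+-identityˡ _))

  Vanish-⊗ a b [] g v w i _ = refl
  Vanish-⊗ zero b (x ∷ f) g v w =
    Vanish-cong (⊗-congʳ g (∷-cong {x} refl (≈-sym (Vanish-0 f (Vanish-tail v)))))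
      (Vanish-const x g w)
  Vanish-⊗ (suc a) b (x ∷ f) g v w = Vanish-⊕ (scale x g) (shift (f ⊗ g))
    (λ i l → trans (coef-scale x g i)
      (trans (cong (x *ᶠ_) (w i (ℕₚ.≤-trans (s≤s (ℕₚ.m≤n+m b (suc a))) l))) (K.zeroʳ x)))
    (Vanish-∷ (Vanish-⊗ a b f g (Vanish-tail v) w))

  Mon-⊗ : ∀ {a b f g} → Mon a f → Mon b g → Mon (a ℕ.+ b) (f ⊗ g)
  Mon-⊗ {a} {b} {f} {g} m n = mkMon
    (trans (coef-⊗-lead a b f g (high m) (high n))
      (trans (cong₂ _*ᶠ_ (lead m) (lead n)) (K.*-identityˡ 1#)))
    (Vanish-⊗ a b f g (high m) (high n))

  Mon-unique : ∀ {a b f} → Mon a f → Mon b f → a ≡ b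
  Mon-unique {a} {b} m n with ℕₚ.<-cmp a b
  ... | tri< a<b _ _ = contradiction (trans (sym (high m b a<b)) (lead n)) 0≢1
  ... | tri≈ _ a≡b _ = a≡b
  ... | tri> _ _ b<a = contradiction (trans (sym (high n a b<a)) (lead m)) 0≢1

  Mon-≉[] : ∀ {n f} → Mon n f → ¬ f ≈ []
  Mon-≉[] {n} m e = 0≢1 (trans (sym (at e n)) (lead m))

  Mon-0 : ∀ {f} → Mon 0 f → f ≈ [ 1# ]
  Mon-0 m .at zero    = lead m
  Mon-0 m .at (suc i) = high m (suc i) (s≤s z≤n)

  Mon-1 : Mon 0 [ 1# ]
  Mon-1 = mkMon refl λ { (suc i) _ → refl }

  -- Horner's scheme: if f = s D + r, then a + x f = (x s) D + (a + x r). The last term has degree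
  -- at most m, and subtracting c D, with c its coefficient at x^m, lowers the degree below m
  -- because D is monic.
  divMod : ∀ {m D} → Mon m D → ∀ f → ∃₂ λ s r → f ≈ s ⊗ D ⊕ r × Vanish m r
  divMod mD [] = [] , [] , ≈-refl , λ _ _ → refl
  divMod {m} {D} mD (a ∷ f) with divMod mD f
  ... | s , r , f≈ , vr = [ c ] ⊕ shift s , r′ ⊕ [ -ᶠ c ] ⊗ D , eq , vr′
    where
    r′ = a ∷ r
    c = coef r′ m
    eq : a ∷ f ≈ ([ c ] ⊕ shift s) ⊗ D ⊕ (r′ ⊕ [ -ᶠ c ] ⊗ D)
    eq = begin
      a ∷ f
        ≈⟨ ∷-cong (sym (K.+-identityˡ a)) f≈ ⟩
      shift (s ⊗ D) ⊕ r′
        ≈⟨ ⊕-congʳ r′ (≈-sym (shift-⊗ s D)) ⟩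
      shift s ⊗ D ⊕ r′
        ≈⟨ R.+-identityˡ _ ⟨
      [] ⊗ D ⊕ (shift s ⊗ D ⊕ r′)
        ≈⟨ ⊕-congʳ (shift s ⊗ D ⊕ r′) (⊗-congʳ D zero≈) ⟩
      ([ c ] ⊕ [ -ᶠ c ]) ⊗ D ⊕ (shift s ⊗ D ⊕ r′)
        ≈⟨ solve 5 (λ c n s D r → (c :+ n) :* D :+ (s :* D :+ r) := (c :+ s) :* D :+ (r :+ n :* D))
             ≈-refl [ c ] [ -ᶠ c ] (shift s) D r′ ⟩
      ([ c ] ⊕ shift s) ⊗ D ⊕ (r′ ⊕ [ -ᶠ c ] ⊗ D) ∎
      where
      zero≈ : [] ≈ [ c ] ⊕ [ -ᶠ c ]
      zero≈ = ≈-sym (≈-trans (∷-cong (K.-‿inverseʳ c) ≈-refl) shift-[])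
    vr′ : Vanish m (r′ ⊕ [ -ᶠ c ] ⊗ D)
    vr′ = Vanish-pred (r′ ⊕ [ -ᶠ c ] ⊗ D)
      (Vanish-⊕ r′ ([ -ᶠ c ] ⊗ D) (Vanish-∷ vr) (Vanish-const (-ᶠ c) D (high mD)))
      (trans (coef-⊕ r′ ([ -ᶠ c ] ⊗ D) m)
        (trans (cong (c +ᶠ_) (trans (coef-const (-ᶠ c) D m) (trans (cong ((-ᶠ c) *ᶠ_) (lead mD)) (K.*-identityʳ _))))
          (K.-‿inverseʳ c)))

  -- A nonzero f of degree below m together with its monic associate. Both directions are kept: `f≈`
  -- serves to compare leading coefficients, `≈f` to transfer divisibility and vanishing to the
  -- monic polynomial.
  record Normalised (m : ℕ) (f : Pol) : Set where
    field
      deg     : ℕ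
      deg<    : deg < m
      c       : Carrier
      c⁻¹     : Carrier
      inv     : c *ᶠ c⁻¹ ≡ 1#
      monic   : Pol
      isMonic : Mon deg monic
      f≈      : f ≈ [ c ] ⊗ monic
      ≈f      : monic ≈ [ c⁻¹ ] ⊗ f

  const-const : ∀ {a b} → a *ᶠ b ≡ 1# → ∀ f → [ a ] ⊗ ([ b ] ⊗ f) ≈ f
  const-const {a} {b} e f .at i = trans (coef-const a ([ b ] ⊗ f) i)
    (trans (cong (a *ᶠ_) (coef-const b f i))
      (trans (sym (K.*-assoc a b _)) (trans (cong (_*ᶠ coef f i) e) (K.*-identityˡ _))))

  normalise : ∀ m f → Vanish m f → f ≈ [] ⊎ Normalised m f
  normalise zero    f v = inj₁ (Vanish-0 f v)
  normalise (suc m) f v with coef f m ≟ᶠ 0#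
  ... | no c≢0 with inverse (coef f m) c≢0
  ...   | d , inv = inj₂ record
    { deg = m ; deg< = ℕₚ.≤-refl ; c = coef f m ; c⁻¹ = d ; inv = inv
    ; monic = [ d ] ⊗ f
    ; isMonic = mkMon (trans (coef-const d f m) (trans (K.*-comm d _) inv)) (Vanish-const d f v)
    ; f≈ = ≈-sym (const-const inv f) ; ≈f = ≈-refl }
  normalise (suc m) f v | yes c≡0 with normalise m f (Vanish-pred f v c≡0)
  ... | inj₁ z = inj₁ z
  ... | inj₂ n = inj₂ record
    { deg = deg ; deg< = ℕₚ.m≤n⇒m≤1+n deg< ; c = c ; c⁻¹ = c⁻¹ ; inv = inv
    ; monic = monic ; isMonic = isMonic ; f≈ = f≈ ; ≈f = ≈f }
    where open Normalised n

  Vanish-length : ∀ f → Vanish (length f) f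
  Vanish-length []      i       _         = refl
  Vanish-length (a ∷ f) (suc i) (s≤s l≤i) = Vanish-length f i l≤i

  -- If s were nonzero, its monic associate times D would have leading coefficient 1 in a degree at
  -- least m. Uniqueness of remainders and cancellation both rest on this.
  small-multiple : ∀ {m D} → Mon m D → ∀ s → Vanish m (s ⊗ D) → s ≈ []
  small-multiple {m} {D} mD s v with normalise (length s) s (Vanish-length s)
  ... | inj₁ s≈0 = s≈0
  ... | inj₂ n = contradiction
      (trans (sym (v′ (deg ℕ.+ m) (ℕₚ.m≤n+m m deg))) (lead (Mon-⊗ isMonic mD))) 0≢1
    where
    open Normalised n
    v′ : Vanish m (monic ⊗ D)
    v′ = Vanish-cong (begin
      [ c⁻¹ ] ⊗ (s ⊗ D)    ≈⟨ R.*-assoc [ c⁻¹ ] s D ⟨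
      [ c⁻¹ ] ⊗ s ⊗ D      ≈⟨ ⊗-congʳ D ≈f ⟨
      monic ⊗ D            ∎) (Vanish-const c⁻¹ (s ⊗ D) v)

  ⊗-cancelʳ : ∀ {m D} → Mon m D → ∀ s t → s ⊗ D ≈ t ⊗ D → s ≈ t
  ⊗-cancelʳ {m} {D} mD s t e = R.x∙y⁻¹≈ε⇒x≈y s t
    (small-multiple mD (s ⊕ neg t) (Vanish-cong (≈-sym diff≈0) λ _ _ → refl))
    where
    diff≈0 : (s ⊕ neg t) ⊗ D ≈ []
    diff≈0 = begin
      (s ⊕ neg t) ⊗ D        ≈⟨ R.distribʳ D s (neg t) ⟩
      s ⊗ D ⊕ neg t ⊗ D      ≈⟨ ⊕-congʳ (neg t ⊗ D) e ⟩
      t ⊗ D ⊕ neg t ⊗ D      ≈⟨ R.distribʳ D t (neg t) ⟨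
      (t ⊕ neg t) ⊗ D        ≈⟨ ⊗-congʳ D (⊕-inverseʳ t) ⟩
      [] ∎

  infix 4 _∣_
  _∣_ : Pol → Pol → Set
  D ∣ f = ∃ λ s → f ≈ s ⊗ D

  ∣-resp : ∀ {D D′ f f′} → D ≈ D′ → f ≈ f′ → D ∣ f → D′ ∣ f′
  ∣-resp D≈ f≈ (s , e) = s , ≈-trans (≈-sym f≈) (≈-trans e (⊗-congˡ s D≈))

  ∣-const : ∀ {D f} c → D ∣ f → D ∣ [ c ] ⊗ f
  ∣-const {D} {f} c (s , e) = [ c ] ⊗ s , ≈-trans (⊗-congˡ [ c ] e) (≈-sym (R.*-assoc [ c ] s D))

  -- Write s = c s′ with s′ monic. Then f = c (s′ D), where s′ D is monic of degree deg s′ + m;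
  -- comparing leading terms with the monic f gives the degrees and c = 1.
  quotient-Mon : ∀ {m n D f s} → Mon m D → Mon n f → f ≈ s ⊗ D → ∃ λ k → Mon k s × k ℕ.+ m ≡ n
  quotient-Mon {m} {n} {D} {f} {s} mD mf e with normalise (length s) s (Vanish-length s)
  ... | inj₁ s≈0 = contradiction (≈-trans e (⊗-congʳ D s≈0)) (Mon-≉[] mf)
  ... | inj₂ nm = deg , Mon-cong (≈-sym s≈monic) isMonic , deg+m≡n
    where
    open Normalised nm
    mD′ : Mon (deg ℕ.+ m) (monic ⊗ D)
    mD′ = Mon-⊗ isMonic mD
    coef-f : ∀ i → coef f i ≡ c *ᶠ coef (monic ⊗ D) i
    coef-f i = trans (at (≈-trans e (≈-trans (⊗-congʳ D f≈) (R.*-assoc [ c ] monic D))) i)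
      (coef-const c (monic ⊗ D) i)
    coef-lead : coef f (deg ℕ.+ m) ≡ c
    coef-lead = trans (coef-f _) (trans (cong (c *ᶠ_) (lead mD′)) (K.*-identityʳ c))
    deg+m≡n : deg ℕ.+ m ≡ n
    deg+m≡n with ℕₚ.<-cmp (deg ℕ.+ m) n
    ... | tri< l _ _ = contradiction
      (trans (sym (trans (coef-f n) (trans (cong (c *ᶠ_) (high mD′ n l)) (K.zeroʳ c)))) (lead mf)) 0≢1
    ... | tri≈ _ e _ = e
    ... | tri> _ _ l = contradiction
      (trans (sym (trans (cong (_*ᶠ c⁻¹) c≡0) (K.zeroˡ c⁻¹))) inv) 0≢1
      where c≡0 = trans (sym coef-lead) (high mf _ l)
    s≈monic : s ≈ monic
    s≈monic = ≈-trans f≈ (≈-trans (⊗-congʳ monic {g = [ c ]} (∷-cong c≡1 ≈-refl)) (R.*-identityˡ monic))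
      where c≡1 = trans (sym coef-lead) (subst (λ i → coef f i ≡ 1#) (sym deg+m≡n) (lead mf))

  ≈[]? : ∀ f → Dec (f ≈ [])
  ≈[]? f with normalise (length f) f (Vanish-length f)
  ... | inj₁ e = yes e
  ... | inj₂ n = no λ e → Mon-≉[] isMonic (≈-trans ≈f (≈-trans (⊗-congˡ [ c⁻¹ ] e) shift-[]))
    where open Normalised n

  remainder-∣ : ∀ {D s r} → D ∣ s ⊗ D ⊕ r → D ∣ r
  remainder-∣ {D} {s} {r} (t , e) = t ⊕ neg s , (begin
    r                          ≈⟨ ⊕-congʳ r (R.-‿inverseˡ (s ⊗ D)) ⟨
    neg (s ⊗ D) ⊕ s ⊗ D ⊕ r    ≈⟨ R.+-assoc (neg (s ⊗ D)) (s ⊗ D) r ⟩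
    neg (s ⊗ D) ⊕ (s ⊗ D ⊕ r)  ≈⟨ ⊕-congˡ (neg (s ⊗ D)) e ⟩
    neg (s ⊗ D) ⊕ t ⊗ D        ≈⟨ R.+-comm (neg (s ⊗ D)) (t ⊗ D) ⟩
    t ⊗ D ⊕ neg (s ⊗ D)        ≈⟨ ⊕-congˡ (t ⊗ D) (R.-‿distribˡ-* s D) ⟩
    t ⊗ D ⊕ neg s ⊗ D          ≈⟨ R.distribʳ D t (neg s) ⟨
    (t ⊕ neg s) ⊗ D            ∎)

  dec-∣ : ∀ {m D} → Mon m D → ∀ f → Dec (D ∣ f)
  dec-∣ {m} {D} mD f with divMod mD f
  ... | s , r , f≈ , vr with ≈[]? r
  ...   | yes r≈0 = yes (s , ≈-trans f≈ (≈-trans (⊕-congˡ (s ⊗ D) r≈0) (⊕-identityʳ (s ⊗ D))))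
  ...   | no r≉0 = no λ D∣f → r≉0 (r≈0 (remainder-∣ {s = s} (∣-resp ≈-refl f≈ D∣f)))
    where
    r≈0 : D ∣ r → r ≈ []
    r≈0 (t , e) = ≈-trans e (⊗-congʳ D (small-multiple mD t (Vanish-cong e vr)))

  -- Irreducibility with factors taken up to `_≈_`, free of any condition on list lengths. That such
  -- a P is prime in the usual sense is `euclid`.
  Prime : ℕ → Pol → Set
  Prime d P = Mon d P × 1 ≤ d × (∀ {a b f g} → Mon a f → Mon b g → 1 ≤ a → 1 ≤ b → ¬ (P ≈ f ⊗ g))

  -- Descent: dividing Q by r replaces r by a monic polynomial of smaller degree.
  euclid-small : ∀ {d Q} → Prime d Q → ∀ g k → ∀ j {r} → j < k → j < d → Mon j r → Q ∣ r ⊗ g → Q ∣ g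
  euclid-small pQ g (suc k) zero {r} _ _ mr Q∣rg =
    ∣-resp ≈-refl (≈-trans (⊗-congʳ g (Mon-0 mr)) (⊗-identityˡ g)) Q∣rg
  euclid-small {d} {Q} pQ@(mQ , _ , irr) g (suc k) (suc j) {r} (s≤s j<k) j<d mr Q∣rg@(t , rg≈)
    with divMod mr Q
  ... | s , r′ , Q≈ , vr′ with normalise (suc j) r′ vr′
  ...   | inj₁ r′≈0 = contradiction Q≈sr (irr ms mr 1≤e (s≤s z≤n))
    where
    Q≈sr : Q ≈ s ⊗ r
    Q≈sr = ≈-trans Q≈ (≈-trans (⊕-congˡ (s ⊗ r) r′≈0) (⊕-identityʳ (s ⊗ r)))
    quot = quotient-Mon {s = s} mr mQ Q≈sr
    ms = proj₁ (proj₂ quot)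
    1≤e : 1 ≤ proj₁ quot
    1≤e = ℕₚ.+-cancelʳ-< (suc j) 0 _ (subst (suc j <_) (sym (proj₂ (proj₂ quot))) j<d)
  ...   | inj₂ n = euclid-small pQ g k deg (ℕₚ.<-≤-trans deg< j<k) (ℕₚ.<-trans deg< j<d) isMonic
      (∣-resp ≈-refl eq (∣-const c⁻¹ Q∣r′g))
    where
    open Normalised n
    Q∣r′g : Q ∣ r′ ⊗ g
    Q∣r′g = remainder-∣ {s = s ⊗ t} (g , (begin
      s ⊗ t ⊗ Q ⊕ r′ ⊗ g      ≈⟨ ⊕-congʳ (r′ ⊗ g) (≈-trans (R.*-assoc s t Q) (⊗-congˡ s (≈-sym rg≈))) ⟩
      s ⊗ (r ⊗ g) ⊕ r′ ⊗ g    ≈⟨ solve 4 (λ s r r′ g → s :* (r :* g) :+ r′ :* g := g :* (s :* r :+ r′)) ≈-refl s r r′ g ⟩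
      g ⊗ (s ⊗ r ⊕ r′)        ≈⟨ ⊗-congˡ g Q≈ ⟨
      g ⊗ Q                   ∎))
    eq : [ c⁻¹ ] ⊗ (r′ ⊗ g) ≈ monic ⊗ g
    eq = ≈-trans (≈-sym (R.*-assoc [ c⁻¹ ] r′ g)) (⊗-congʳ g (≈-sym ≈f))

  -- Modulo Q the factor f may be replaced by its remainder r. Either r = 0, or r can be made monic
  -- of degree below d, where the descent of `euclid-small` applies.
  euclid : ∀ {d Q} → Prime d Q → ∀ f g → Q ∣ f ⊗ g → Q ∣ f ⊎ Q ∣ g
  euclid {d} {Q} pQ@(mQ , _) f g Q∣fg@(t , fg≈) with divMod mQ f
  ... | s , r , f≈sQ+r , vr with normalise d r vr
  ...   | inj₁ r≈0 = inj₁ (s , ≈-trans f≈sQ+r (≈-trans (⊕-congˡ (s ⊗ Q) r≈0) (⊕-identityʳ (s ⊗ Q))))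
  ...   | inj₂ n = inj₂ (euclid-small pQ g d deg deg< deg< isMonic (∣-resp ≈-refl eq (∣-const c⁻¹ Q∣rg)))
    where
    open Normalised n
    Q∣rg : Q ∣ r ⊗ g
    Q∣rg = remainder-∣ {s = s ⊗ g} (t , (begin
      s ⊗ g ⊗ Q ⊕ r ⊗ g    ≈⟨ solve 4 (λ s g Q r → s :* g :* Q :+ r :* g := (s :* Q :+ r) :* g) ≈-refl s g Q r ⟩
      (s ⊗ Q ⊕ r) ⊗ g      ≈⟨ ⊗-congʳ g f≈sQ+r ⟨
      f ⊗ g                ≈⟨ fg≈ ⟩
      t ⊗ Q                ∎))
    eq : [ c⁻¹ ] ⊗ (r ⊗ g) ≈ monic ⊗ g
    eq = ≈-trans (≈-sym (R.*-assoc [ c⁻¹ ] r g)) (⊗-congʳ g (≈-sym ≈f))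

  Prime-∣-Prime : ∀ {d e P Q} → Prime d P → Prime e Q → Q ∣ P → P ≈ Q
  Prime-∣-Prime {P = P} {Q} (mP , _ , irr) (mQ , 1≤e , _) (s , P≈) with quotient-Mon {s = s} mQ mP P≈
  ... | suc k , ms , _ = contradiction P≈ (irr ms mQ (s≤s z≤n) 1≤e)
  ... | zero  , ms , _ = ≈-trans P≈ (≈-trans (⊗-congʳ Q (Mon-0 ms)) (⊗-identityˡ Q))

  infixr 8 _^P_
  _^P_ : Pol → ℕ → Pol
  P ^P zero  = [ 1# ]
  P ^P suc k = P ⊗ P ^P k

  Mon-^ : ∀ {d P} → Mon d P → ∀ k → Mon (k ℕ.* d) (P ^P k)
  Mon-^ m zero    = Mon-1
  Mon-^ m (suc k) = Mon-⊗ m (Mon-^ m k)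

  ∣-⊗ˡ : ∀ {D f} g → D ∣ f → D ∣ g ⊗ f
  ∣-⊗ˡ {D} g (s , e) = g ⊗ s , ≈-trans (⊗-congˡ g e) (≈-sym (R.*-assoc g s D))

  -- Since Q does not divide P, Euclid's lemma gives g = g′ Q. Cancelling one Q leaves Q^k ∣ P g′,
  -- to which the induction applies. So a factor P does not affect the multiplicity of another
  -- prime.
  ^-∣-⊗ : ∀ {d e P Q} → Prime d P → Prime e Q → ¬ P ≈ Q → ∀ k g → Q ^P k ∣ P ⊗ g → Q ^P k ∣ g
  ^-∣-⊗ pP pQ P≉Q zero g _ = g , ≈-sym (R.*-identityʳ g)
  ^-∣-⊗ {P = P} {Q} pP pQ P≉Q (suc k) g Q∣Pg@(t , e) with euclid pQ P g (t ⊗ Q ^P k , ≈-trans e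
      (solve 3 (λ t Q x → t :* (Q :* x) := t :* x :* Q) ≈-refl t Q (Q ^P k)))
  ... | inj₁ Q∣P = contradiction (Prime-∣-Prime pP pQ Q∣P) P≉Q
  ... | inj₂ (g′ , g≈) with ^-∣-⊗ pP pQ P≉Q k g′ (t , ⊗-cancelʳ (proj₁ pQ) (P ⊗ g′) (t ⊗ Q ^P k) (begin
      P ⊗ g′ ⊗ Q          ≈⟨ R.*-assoc P g′ Q ⟩
      P ⊗ (g′ ⊗ Q)        ≈⟨ ⊗-congˡ P g≈ ⟨
      P ⊗ g               ≈⟨ e ⟩
      t ⊗ (Q ⊗ Q ^P k)    ≈⟨ solve 3 (λ t Q x → t :* (Q :* x) := t :* x :* Q) ≈-refl t Q (Q ^P k) ⟩
      t ⊗ Q ^P k ⊗ Q      ∎))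
  ...   | u , g′≈ = u , (begin
      g                   ≈⟨ g≈ ⟩
      g′ ⊗ Q              ≈⟨ ⊗-congʳ Q g′≈ ⟩
      u ⊗ Q ^P k ⊗ Q      ≈⟨ solve 3 (λ t Q x → t :* x :* Q := t :* (Q :* x)) ≈-refl u Q (Q ^P k) ⟩
      u ⊗ (Q ⊗ Q ^P k)    ∎)

  -- Together with `⊗-^suc-∣` this says that a factor P raises the multiplicity of P itself by
  -- exactly one.
  ^suc-∣-⊗ : ∀ {d P} → Mon d P → ∀ k g → P ^P suc k ∣ P ⊗ g → P ^P k ∣ g
  ^suc-∣-⊗ {P = P} mP k g (t , e) = t , ⊗-cancelʳ mP g (t ⊗ P ^P k) (begin
    g ⊗ P               ≈⟨ R.*-comm g P ⟩
    P ⊗ g               ≈⟨ e ⟩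
    t ⊗ (P ⊗ P ^P k)    ≈⟨ solve 3 (λ t Q x → t :* (Q :* x) := t :* x :* Q) ≈-refl t P (P ^P k) ⟩
    t ⊗ P ^P k ⊗ P      ∎)

  ⊗-^suc-∣ : ∀ {P} k g → P ^P k ∣ g → P ^P suc k ∣ P ⊗ g
  ⊗-^suc-∣ {P} k g (t , e) = t , ≈-trans (⊗-congˡ P e)
    (solve 3 (λ t Q x → Q :* (t :* x) := t :* (Q :* x)) ≈-refl t P (P ^P k))

  ∣⇒≤ : ∀ {m n D f} → Mon m D → Mon n f → D ∣ f → m ≤ n
  ∣⇒≤ {m} mD mf (s , e) with quotient-Mon {s = s} mD mf e
  ... | k , _ , k+m≡n = subst (m ≤_) k+m≡n (ℕₚ.m≤n+m m k)

-- Gauss's formula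

module PolynomialCounting {q : ℕ} (F : FiniteField q) where

  open FiniteField F renaming (_+_ to _+ᶠ_; _*_ to _*ᶠ_; -_ to -ᶠ_)
  open Poly F renaming (addP to infixl 6 _⊕_; mulP to infixl 7 _⊗_)
  open Polynomials F
  open PolynomialDivisibility F

  tail : Pol → Pol
  tail []      = []
  tail (a ∷ f) = f

  coef-tail : ∀ f i → coef (tail f) i ≡ coef f (suc i)
  coef-tail []      i = refl
  coef-tail (a ∷ f) i = refl

  -- Inverse to `toPol` on polynomials with `Mon n f`, where the coefficients dropped are 1, 0, 0,
  -- ...
  monicOf : ∀ n → Pol → Monic n
  monicOf zero    f = []
  monicOf (suc n) f = coef f 0 ∷ monicOf n (tail f)

  Mon-tail : ∀ {n} f → Mon (suc n) f → Mon n (tail f)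
  Mon-tail {n} f (mkMon l h) = mkMon (trans (coef-tail f n) l) λ i n<i → trans (coef-tail f i) (h (suc i) (s≤s n<i))

  toPol-monicOf : ∀ n f → Mon n f → toPol (monicOf n f) ≈ f
  toPol-monicOf zero    f m = ≈-sym (Mon-0 m)
  toPol-monicOf (suc n) f m .at zero    = refl
  toPol-monicOf (suc n) f m .at (suc i) =
    trans (at (toPol-monicOf n (tail f) (Mon-tail f m)) i) (coef-tail f i)

  Mon-toPol : ∀ {n} (c : Monic n) → Mon n (toPol c)
  Mon-toPol []      = Mon-1
  Mon-toPol (a ∷ c) = mkMon (lead (Mon-toPol c)) (Vanish-∷ {a = a} (high (Mon-toPol c)))
    where open Mon

  toPol-injective : ∀ {n} (c d : Monic n) → toPol c ≈ toPol d → c ≡ d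
  toPol-injective []      []      e = refl
  toPol-injective (a ∷ c) (b ∷ d) e =
    cong₂ _∷_ (at e 0) (toPol-injective c d (mk≈ (at e ∘ suc)))

  length-toPol : ∀ {n} (c : Monic n) → length (toPol c) ≡ suc n
  length-toPol []      = refl
  length-toPol (a ∷ c) = cong suc (length-toPol c)

  length-⊕ : ∀ f g → length f ≤ length g → length (f ⊕ g) ≡ length g
  length-⊕ []      g       _       = refl
  length-⊕ (a ∷ f) (b ∷ g) (s≤s l) = cong suc (length-⊕ f g l)

  -- `Irreducible` compares lists by `_≡_`, whereas division yields factors only up to `_≈_`. A
  -- product of two monic lists has no trailing zeros, so equal lengths turn one relation into the
  -- other (`≈⇒≡`).
  length-⊗ : ∀ a b f g → length f ≡ suc a → length g ≡ suc b → length (f ⊗ g) ≡ suc (a + b)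
  length-⊗ zero b (x ∷ []) (y ∷ g) _ e = cong suc
    (trans (cong length (⊕-[] (scale x g))) (trans (length-map (x *ᶠ_) g) (ℕₚ.suc-injective e)))
    where
    ⊕-[] : ∀ f → f ⊕ [] ≡ f
    ⊕-[] []      = refl
    ⊕-[] (a ∷ f) = refl
  length-⊗ (suc a) b (x ∷ f) g e e′ = trans (length-⊕ (scale x g) (shift (f ⊗ g)) l) (cong suc ih)
    where
    ih = length-⊗ a b f g (ℕₚ.suc-injective e) e′
    l : length (scale x g) ≤ suc (length (f ⊗ g))
    l = subst₂ _≤_ (sym (trans (length-map (x *ᶠ_) g) e′)) (cong suc (sym ih)) (s≤s (ℕₚ.m≤n⇒m≤1+n (ℕₚ.m≤n+m b a)))

  ≈⇒≡ : ∀ f g → length f ≡ length g → f ≈ g → f ≡ g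
  ≈⇒≡ []      []      _ _ = refl
  ≈⇒≡ (a ∷ f) (b ∷ g) l e = cong₂ _∷_ (at e 0) (≈⇒≡ f g (ℕₚ.suc-injective l) (mk≈ (at e ∘ suc)))

  Irreducible⇒Prime : ∀ {n} (P : Monic n) → Irreducible P → Prime n (toPol P)
  Irreducible⇒Prime {n} P (1≤n , irr) = Mon-toPol P , 1≤n , prime
    where
    prime : ∀ {a b f g} → Mon a f → Mon b g → 1 ≤ a → 1 ≤ b → ¬ (toPol P ≈ f ⊗ g)
    prime {a} {b} {f} {g} mf mg 1≤a 1≤b P≈ = irr (a , b , f′ , g′ , 1≤a , 1≤b ,
      ≈⇒≡ (toPol P) (toPol f′ ⊗ toPol g′)
        (trans (length-toPol P) (trans (cong suc n≡a+b)
          (sym (length-⊗ a b (toPol f′) (toPol g′) (length-toPol f′) (length-toPol g′)))))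
        (≈-trans P≈ (⊗-cong (≈-sym (toPol-monicOf a f mf)) (≈-sym (toPol-monicOf b g mg)))))
      where
      f′ = monicOf a f
      g′ = monicOf b g
      n≡a+b : n ≡ a + b
      n≡a+b = Mon-unique (Mon-toPol P) (Mon-cong (≈-sym P≈) (Mon-⊗ mf mg))

  -- Enumeration of monic polynomials and of their multiples

  elements : List Carrier
  elements = map (Inverse.to card) (allFin q)

  elements-unique : Unique elements
  elements-unique = Uniqueₚ.map⁺ (λ {x} {y} e → trans (sym (Inverse.strictlyInverseʳ card x))
    (trans (cong (Inverse.from card) e) (Inverse.strictlyInverseʳ card y))) (Uniqueₚ.allFin⁺ q)

  ∈-elements : ∀ a → a ∈ elements
  ∈-elements a = subst (_∈ elements) (Inverse.strictlyInverseˡ card a)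
    (∈-map⁺ (Inverse.to card) (∈-allFin (Inverse.from card a)))

  monics : ∀ n → List (Monic n)
  monics zero    = [] ∷ []
  monics (suc n) = cartesianProductWith _∷_ elements (monics n)

  monics-unique : ∀ n → Unique (monics n)
  monics-unique zero    = [] ∷ []
  monics-unique (suc n) = Uniqueₚ.cartesianProductWith⁺ _∷_ ∷-injective elements-unique (monics-unique n)

  ∈-monics : ∀ {n} (c : Monic n) → c ∈ monics n
  ∈-monics []      = here refl
  ∈-monics (a ∷ c) = ∈-cartesianProductWith⁺ _∷_ (∈-elements a) (∈-monics c)

  length-monics : ∀ n → length (monics n) ≡ q ^ n
  length-monics zero    = refl
  length-monics (suc n) = trans (length-product elements (monics n))
    (cong₂ _*_ (trans (length-map (Inverse.to card) (allFin q)) (length-tabulate {n = q} (λ i → i))) (length-monics n))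
    where
    length-product : ∀ {n} xs (ys : List (Monic n)) →
      length (cartesianProductWith _∷_ xs ys) ≡ length xs * length ys
    length-product []       ys = refl
    length-product (x ∷ xs) ys = trans (length-++ (map (x ∷_) ys))
      (cong₂ _+_ (length-map (x ∷_) ys) (length-product xs ys))

  -- The indicator guards the truncated subtraction: for m > n the power alone would be q^0 = 1
  -- instead of 0.
  #multiples : ℕ → ℕ → ℕ
  #multiples n m = 𝟙 (m ℕ.≤? n) * q ^ (n ∸ m)

  -- Multiplication by D is a bijection from the monic polynomials of degree n - m onto the
  -- multiples of D among those of degree n. It appears as two duplicate-free lists with the same
  -- members, hence of the same length.
  count-multiples : ∀ {m D} (mD : Mon m D) n →
    ∑ (monics n) (λ f → 𝟙 (dec-∣ mD (toPol f))) ≡ #multiples n m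
  count-multiples {m} {D} mD n = by-cases (m ℕ.≤? n)
    where
    by-cases : Dec (m ≤ n) → ∑ (monics n) (λ f → 𝟙 (dec-∣ mD (toPol f))) ≡ #multiples n m
    by-cases (no m≰n) = trans
      (∑-zero (monics n) λ {f} _ → 𝟙-no (dec-∣ mD (toPol f)) (m≰n ∘ ∣⇒≤ mD (Mon-toPol f)))
      (cong (_* q ^ (n ∸ m)) (sym (𝟙-no (m ℕ.≤? n) m≰n)))
    by-cases (yes m≤n) = begin
      ∑ (monics n) (λ f → 𝟙 (D∣? f))    ≡⟨ ∑-filter D∣? (monics n) ⟩
      length (filter D∣? (monics n))    ≡⟨ ↭-length (∼bag⇒↭ (unique∧set⇒bag
                                             (Uniqueₚ.filter⁺ D∣? (monics-unique n))
                                             (Uniqueₚ.map⁺ D*-injective (monics-unique k))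
                                             (mk⇔ divisible⇒multiple multiple⇒divisible))) ⟩
      length (map D* (monics k))        ≡⟨ length-map D* (monics k) ⟩
      length (monics k)                 ≡⟨ length-monics k ⟩
      q ^ k                             ≡⟨ ℕₚ.*-identityˡ (q ^ k) ⟨
      1 * q ^ k                         ≡⟨ cong (_* q ^ k) (𝟙-yes (m ℕ.≤? n) m≤n) ⟨
      #multiples n m                    ∎
      where
      open ≡-Reasoning
      k = n ∸ m
      k+m≡n : k + m ≡ n
      k+m≡n = ℕₚ.m∸n+n≡m m≤n
      D∣? : (f : Monic n) → Dec (D ∣ toPol f)
      D∣? f = dec-∣ mD (toPol f)
      D* : Monic k → Monic n
      D* g = monicOf n (toPol g ⊗ D)
      Mon-D* : ∀ g → Mon n (toPol g ⊗ D)
      Mon-D* g = subst (λ i → Mon i (toPol g ⊗ D)) k+m≡n (Mon-⊗ (Mon-toPol g) mD)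
      D*-injective : ∀ {g h} → D* g ≡ D* h → g ≡ h
      D*-injective {g} {h} e = toPol-injective g h (⊗-cancelʳ mD (toPol g) (toPol h)
        (≈-trans (≈-sym (toPol-monicOf n _ (Mon-D* g)))
          (≈-trans (≈-reflexive (cong toPol e)) (toPol-monicOf n _ (Mon-D* h)))))
      divisible⇒multiple : ∀ {f} → f ∈ filter D∣? (monics n) → f ∈ map D* (monics k)
      divisible⇒multiple {f} f∈ with proj₂ (∈-filter⁻ D∣? {xs = monics n} f∈)
      ... | s , f≈ with quotient-Mon {s = s} mD (Mon-toPol f) f≈
      ...   | k′ , ms , k′+m≡n with ℕₚ.+-cancelʳ-≡ m k′ k (trans k′+m≡n (sym k+m≡n))
      ...     | refl = subst (_∈ map D* (monics k)) (sym f≡) (∈-map⁺ D* (∈-monics (monicOf k s)))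
        where
        f≡ : f ≡ D* (monicOf k s)
        f≡ = toPol-injective f (D* (monicOf k s)) (≈-trans f≈
          (≈-trans (⊗-congʳ D (≈-sym (toPol-monicOf k s ms)))
            (≈-sym (toPol-monicOf n _ (Mon-D* (monicOf k s))))))
      multiple⇒divisible : ∀ {f} → f ∈ map D* (monics k) → f ∈ filter D∣? (monics n)
      multiple⇒divisible f∈ with ∈-map⁻ D* f∈
      ... | g , _ , refl = ∈-filter⁺ D∣? (∈-monics (D* g))
        (toPol g , toPol-monicOf n _ (Mon-D* g))

  -- For e ≤ n the exponent grows by one, for e > n + 1 both counts are 0, and at e = n + 1 the
  -- count jumps from 0 to 1. Only this jump survives in `gauss`.
  #multiples-suc : ∀ n e → #multiples (suc n) e ≡ q * #multiples n e + 𝟙 (e ℕ.≟ suc n)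
  #multiples-suc n e with ℕₚ.<-cmp e (suc n)
  ... | tri< (s≤s e≤n) e≢ _
    rewrite 𝟙-yes (e ℕ.≤? suc n) (ℕₚ.m≤n⇒m≤1+n e≤n) | 𝟙-yes (e ℕ.≤? n) e≤n
          | 𝟙-no (e ℕ.≟ suc n) e≢ | ℕₚ.+-∸-assoc 1 e≤n = lemma q (q ^ (n ∸ e))
    where
    lemma : ∀ a b → 1 * (a * b) ≡ a * (1 * b) + 0
    lemma = solve-∀
  ... | tri≈ e≮ refl _
    rewrite 𝟙-yes (suc n ℕ.≤? suc n) ℕₚ.≤-refl | 𝟙-no (suc n ℕ.≤? n) (ℕₚ.<-irrefl refl)
          | 𝟙-yes (suc n ℕ.≟ suc n) refl | ℕₚ.n∸n≡0 n | ℕₚ.*-zeroʳ q = refl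
  ... | tri> e≮ e≢ e>
    rewrite 𝟙-no (e ℕ.≤? suc n) (ℕₚ.<⇒≱ e>) | 𝟙-no (e ℕ.≤? n) (ℕₚ.<⇒≱ (ℕₚ.<-trans (ℕₚ.n<1+n n) e>))
          | 𝟙-no (e ℕ.≟ suc n) e≢ | ℕₚ.*-zeroʳ q = refl

  module Counting (N : ℕ → ℕ) (counts : CountsIrreducibles F N) where

    module C i = Inverse (counts (suc i) (s≤s z≤n))

    irreducibles : ∀ i → List (Monic (suc i))
    irreducibles i = map (proj₁ ∘ C.to i) (allFin (N (suc i)))

    length-irreducibles : ∀ i → length (irreducibles i) ≡ N (suc i)
    length-irreducibles i = trans (length-map (proj₁ ∘ C.to i) (allFin (N (suc i))))
      (length-tabulate {n = N (suc i)} (λ j → j))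

    -- ⊥ is proof-irrelevant, so an irreducible polynomial is counted only once.
    MonicIrreducible-≡ : ∀ {n} {P Q : MonicIrreducible n} → proj₁ P ≡ proj₁ Q → P ≡ Q
    MonicIrreducible-≡ {P = P , 1≤n , _} {_ , 1≤n′ , _} refl =
      cong (λ l → P , l , _) (ℕₚ.≤-irrelevant 1≤n 1≤n′)

    irreducibles-unique : ∀ i → Unique (irreducibles i)
    irreducibles-unique i = Uniqueₚ.map⁺ (λ {x} {y} e → trans (sym (C.strictlyInverseʳ i x))
      (trans (cong (C.from i) (MonicIrreducible-≡ e)) (C.strictlyInverseʳ i y))) (Uniqueₚ.allFin⁺ (N (suc i)))

    ∈-irreducibles : ∀ {i} (P : Monic (suc i)) → Irreducible P → P ∈ irreducibles i
    ∈-irreducibles {i} P irr = subst (_∈ irreducibles i) (cong proj₁ (C.strictlyInverseˡ i (P , irr)))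
      (∈-map⁺ (proj₁ ∘ C.to i) (∈-allFin (C.from i (P , irr))))

    irreducibles-prime : ∀ {i} {P : Monic (suc i)} → P ∈ irreducibles i → Prime (suc i) (toPol P)
    irreducibles-prime {i} P∈ with ∈-map⁻ (proj₁ ∘ C.to i) P∈
    ... | j , _ , refl = Irreducible⇒Prime _ (proj₂ (C.to i j))

    -- The degree as a weighted count of dividing prime powers

    IrreducibleFactor : Pol → Set
    IrreducibleFactor f = ∃ λ i → ∃ λ (P : Monic (suc i)) → P ∈ irreducibles i × ∃ λ g → f ≈ g ⊗ toPol P

    -- Assume there is no irreducible factor. Then f is not irreducible itself, and by induction no
    -- factor g of smaller degree occurs in a splitting f = g h; so f has no splitting and is
    -- irreducible after all. The bound k on the degree carries the strong induction.
    irreducibleFactor : ∀ k {n} (f : Monic n) → n ≤ k → 1 ≤ n → ¬ ¬ IrreducibleFactor (toPol f)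
    irreducibleFactor (suc k) {suc i} f (s≤s i≤k) _ none = notIrreducible
      (s≤s z≤n , λ (a , b , g , h , 1≤a , 1≤b , f≡) →
        let f≈ = ≈-reflexive f≡
            a+b≡n = Mon-unique (Mon-cong (≈-sym f≈) (Mon-⊗ (Mon-toPol g) (Mon-toPol h))) (Mon-toPol f)
            a≤k = ℕₚ.≤-trans (ℕ.s≤s⁻¹ (subst (a <_) a+b≡n (ℕₚ.m<m+n a 1≤b))) i≤k
        in irreducibleFactor k g a≤k 1≤a λ (j , P , P∈ , s , g≈) →
          none (j , P , P∈ , toPol h ⊗ s , (≈-trans f≈ (≈-trans (⊗-comm (toPol g) (toPol h))
            (≈-trans (⊗-congˡ (toPol h) g≈) (≈-sym (⊗-assoc (toPol h) s (toPol P))))))))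
      where
      notIrreducible : ¬ Irreducible f
      notIrreducible irr = none (i , f , ∈-irreducibles f irr , [ 1# ] , ≈-sym (⊗-identityˡ (toPol f)))

    ∣^? : ∀ {d} (P : Monic d) k f → Dec (toPol P ^P k ∣ f)
    ∣^? P k f = dec-∣ (Mon-^ (Mon-toPol P) k) f

    -- M bounds the degrees i + 1 and the exponents j + 1 alike. For deg f ≤ M nothing is lost, and
    -- with M = n + 1 the sums for degrees n and n + 1 have the same shape.
    module Weight (M : ℕ) where

      localWeight : ∀ i → Monic (suc i) → Pol → ℕ
      localWeight i P f = ∑ (upTo M) λ j → suc i * 𝟙 (∣^? P (suc j) f)

      weight : Pol → ℕ
      weight f = ∑ (upTo M) λ i → ∑ (irreducibles i) λ P → localWeight i P f

      localWeight-other : ∀ {i j} {P : Monic (suc i)} {Q : Monic (suc j)} {f} g → Prime (suc i) (toPol P) → Prime (suc j) (toPol Q) →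
        ¬ toPol P ≈ toPol Q → f ≈ g ⊗ toPol P → localWeight j Q f ≡ localWeight j Q g
      localWeight-other {i} {j} {P} {Q} {f} g pP pQ P≉Q f≈ = ∑-cong (upTo M) λ {k} _ →
        cong (suc j *_) (𝟙-cong (∣^? Q (suc k) f) (∣^? Q (suc k) g)
          (λ d → ^-∣-⊗ pP pQ P≉Q (suc k) g (∣-resp ≈-refl f≈′ d))
          (λ d → ∣-resp ≈-refl (≈-sym f≈′) (∣-⊗ˡ (toPol P) d)))
        where
        f≈′ = ≈-trans f≈ (⊗-comm g (toPol P))

      -- Since P^(j+1) ∣ P g exactly when P^j ∣ g, the exponents 1, ..., M for f become 0, ..., M -
      -- 1 for g. Against 1, ..., M this gains P^0, which always divides, and loses P^M, whose
      -- degree exceeds that of g.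
      localWeight-same : ∀ {i k P f g} → Mon k g → k < M → f ≈ g ⊗ toPol P →
        localWeight i P f ≡ suc i + localWeight i P g
      localWeight-same {i} {k} {P} {f} {g} mg k<M f≈ = begin
        ∑ (upTo M) (λ j → suc i * 𝟙 (∣^? P (suc j) f))
          ≡⟨ ∑-* (suc i) (upTo M) _ ⟩
        suc i * ∑ (upTo M) (λ j → 𝟙 (∣^? P (suc j) f))
          ≡⟨ cong (suc i *_) (∑-cong (upTo M) λ {j} _ → 𝟙-cong (∣^? P (suc j) f) (∣^? P j g)
               (λ d → ^suc-∣-⊗ (Mon-toPol P) j g (∣-resp ≈-refl f≈′ d))
               (λ d → ∣-resp ≈-refl (≈-sym f≈′) (⊗-^suc-∣ j g d))) ⟩
        suc i * ∑ (upTo M) h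
          ≡⟨ cong (suc i *_) (ℕₚ.+-identityʳ _) ⟨
        suc i * (∑ (upTo M) h + 0)
          ≡⟨ cong (λ x → suc i * (∑ (upTo M) h + x)) (𝟙-no (∣^? P M g) P^M∤g) ⟨
        suc i * (∑ (upTo M) h + h M)
          ≡⟨ cong (suc i *_) (∑-upTo-shift M h) ⟩
        suc i * (h 0 + ∑ (upTo M) (h ∘ suc))
          ≡⟨ cong (λ x → suc i * (x + ∑ (upTo M) (h ∘ suc)))
               (𝟙-yes (∣^? P 0 g) (g , ≈-trans (≈-sym (⊗-identityˡ g)) (⊗-comm [ 1# ] g))) ⟩
        suc i * (1 + ∑ (upTo M) (h ∘ suc))
          ≡⟨ ℕₚ.*-suc (suc i) _ ⟩
        suc i + suc i * ∑ (upTo M) (h ∘ suc)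
          ≡⟨ cong (suc i +_) (∑-* (suc i) (upTo M) _) ⟨
        suc i + ∑ (upTo M) (λ j → suc i * h (suc j)) ∎
        where
        open ≡-Reasoning
        h : ℕ → ℕ
        h j = 𝟙 (∣^? P j g)
        f≈′ = ≈-trans f≈ (⊗-comm g (toPol P))
        P^M∤g : ¬ (toPol P ^P M ∣ g)
        P^M∤g d = ℕₚ.<⇒≱ k<M (ℕₚ.≤-trans (ℕₚ.m≤m*n M (suc i)) (∣⇒≤ (Mon-^ (Mon-toPol P) M) mg d))

      weight-factor : ∀ {i k P f g} → i < M → P ∈ irreducibles i → Mon k g → k < M → f ≈ g ⊗ toPol P →
        weight f ≡ suc i + weight g
      weight-factor {i} {k} {P} {f} {g} i<M P∈ mg k<M f≈ =
        ∑-update {f = λ i → ∑ (irreducibles i) λ P → localWeight i P f} (suc i) (Uniqueₚ.upTo⁺ M) (∈-upTo⁺ i<M)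
          (∑-update {f = λ P → localWeight i P f} (suc i) (irreducibles-unique i) P∈
            (localWeight-same mg k<M f≈)
            (λ {Q} Q∈ Q≢P → localWeight-other g pP (irreducibles-prime Q∈)
              (λ P≈Q → Q≢P (sym (toPol-injective P Q P≈Q))) f≈))
          (λ {j} _ j≢i → ∑-cong (irreducibles j) λ {Q} Q∈ → localWeight-other g pP (irreducibles-prime Q∈)
            (λ P≈Q → j≢i (ℕₚ.suc-injective (Mon-unique (Mon-cong (≈-sym P≈Q) (Mon-toPol Q)) (Mon-toPol P)))) f≈)
        where pP = irreducibles-prime P∈

      weight≡degree : ∀ b {n} f → Mon n f → n ≤ b → n ≤ M → weight f ≡ n
      weight≡degree b {zero} f mf _ _ =
        ∑-zero (upTo M) λ {i} _ → ∑-zero (irreducibles i) λ {P} _ → ∑-zero (upTo M) λ {j} _ →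
          trans (cong (suc i *_) (𝟙-no (∣^? P (suc j) f) λ d →
            ℕₚ.1+n≰n (ℕₚ.≤-trans (s≤s z≤n) (∣⇒≤ (Mon-^ (Mon-toPol P) (suc j)) mf d))))
          (ℕₚ.*-zeroʳ (suc i))
      weight≡degree (suc b) {suc n} f mf (s≤s n≤b) n<M =
        -- The goal is an equation between natural numbers, so the double negation on the
        -- irreducible factor may be dropped.
        decidable-stable (weight f ℕ.≟ suc n) λ w≢ →
          irreducibleFactor (suc n) (monicOf (suc n) f) ℕₚ.≤-refl (s≤s z≤n) λ (i , P , P∈ , g , f′≈) →
            w≢ (step i P P∈ g (≈-trans (≈-sym (toPol-monicOf (suc n) f mf)) f′≈))
        where
        step : ∀ i P → P ∈ irreducibles i → ∀ g → f ≈ g ⊗ toPol P → weight f ≡ suc n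
        step i P P∈ g f≈ with quotient-Mon {s = g} (Mon-toPol P) mf f≈
        ... | k , mg , k+d≡n = begin
          weight f            ≡⟨ weight-factor {f = f} i<M P∈ mg k<M f≈ ⟩
          suc i + weight g    ≡⟨ cong (suc i +_) (weight≡degree b g mg k≤b (ℕₚ.<⇒≤ k<M)) ⟩
          suc i + k           ≡⟨ ℕₚ.+-comm (suc i) k ⟩
          k + suc i           ≡⟨ k+d≡n ⟩
          suc n               ∎
          where
          open ≡-Reasoning
          k<n : k < suc n
          k<n = subst (k <_) k+d≡n (ℕₚ.m<m+n k (s≤s z≤n))
          k<M = ℕₚ.<-≤-trans k<n n<M
          k≤b = ℕₚ.≤-trans (ℕ.s≤s⁻¹ k<n) n≤b
          i<M = ℕₚ.≤-trans (ℕₚ.≤-trans (ℕₚ.m≤n+m (suc i) k) (ℕₚ.≤-reflexive k+d≡n)) n<M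

      -- M is allowed to exceed n because `gauss` applies this to n and to n + 1 with the same M.
      total-degree : ∀ n → n ≤ M → n * q ^ n ≡
        ∑ (upTo M) λ i → N (suc i) * ∑ (upTo M) λ j → suc i * #multiples n (suc j * suc i)
      total-degree n n≤M = begin
        n * q ^ n
          ≡⟨ ℕₚ.*-comm n (q ^ n) ⟩
        q ^ n * n
          ≡⟨ cong (_* n) (length-monics n) ⟨
        length (monics n) * n
          ≡⟨ ∑-const (monics n) n ⟨
        ∑ (monics n) (λ _ → n)
          ≡⟨ ∑-cong (monics n) (λ {f} _ → weight≡degree n (toPol f) (Mon-toPol f) ℕₚ.≤-refl n≤M) ⟨
        ∑ (monics n) (λ f → weight (toPol f))
          ≡⟨ ∑-swap (monics n) (upTo M) _ ⟩
        ∑ (upTo M) (λ i → ∑ (monics n) λ f → ∑ (irreducibles i) λ P → localWeight i P (toPol f))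
          ≡⟨ ∑-cong (upTo M) (λ {i} _ → trans (∑-swap (monics n) (irreducibles i) _)
               (trans (∑-cong (irreducibles i) λ {P} _ → sum-localWeight i P)
                 (trans (∑-const (irreducibles i) _) (cong (_* _) (length-irreducibles i))))) ⟩
        ∑ (upTo M) (λ i → N (suc i) * ∑ (upTo M) λ j → suc i * #multiples n (suc j * suc i)) ∎
        where
        open ≡-Reasoning
        sum-localWeight : ∀ i P → ∑ (monics n) (λ f → localWeight i P (toPol f)) ≡
          ∑ (upTo M) λ j → suc i * #multiples n (suc j * suc i)
        sum-localWeight i P = trans (∑-swap (monics n) (upTo M) _)
          (∑-cong (upTo M) λ {j} _ → trans (∑-* (suc i) (monics n) _)
            (cong (suc i *_) (count-multiples (Mon-^ (Mon-toPol P) (suc j)) n)))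

    -- The left side satisfies (n+1) q^(n+1) = q (n q^n) + q^(n+1). By `#multiples-suc` the right
    -- side for n + 1 is q times the one for n plus the terms with k d = n + 1, and cancelling q (n
    -- q^n) leaves q^(n+1) against these.
    gauss : ∀ n → q ^ suc n ≡ ∑ (upTo (suc n)) λ i → 𝟙 (suc i ∣ℕ? suc n) * (suc i * N (suc i))
    gauss n = ℕₚ.+-cancelˡ-≡ (q * (n * q ^ n)) _ _ (begin
      q * (n * q ^ n) + q ^ suc n
        ≡⟨ lemma q n (q ^ n) ⟩
      suc n * q ^ suc n
        ≡⟨ total-degree (suc n) ℕₚ.≤-refl ⟩
      ∑ xs (λ i → N (suc i) * ∑ xs λ j → suc i * #multiples (suc n) (suc j * suc i))
        ≡⟨ ∑-cong xs (λ {i} _ → split i) ⟩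
      ∑ xs (λ i → q * (N (suc i) * ∑ xs λ j → suc i * #multiples n (suc j * suc i))
                  + 𝟙 (suc i ∣ℕ? suc n) * (suc i * N (suc i)))
        ≡⟨ ∑-+ xs (λ i → q * (N (suc i) * ∑ xs λ j → suc i * #multiples n (suc j * suc i)))
             (λ i → 𝟙 (suc i ∣ℕ? suc n) * (suc i * N (suc i))) ⟩
      ∑ xs (λ i → q * (N (suc i) * ∑ xs λ j → suc i * #multiples n (suc j * suc i)))
        + ∑ xs (λ i → 𝟙 (suc i ∣ℕ? suc n) * (suc i * N (suc i)))
        ≡⟨ cong (_+ ∑ xs (λ i → 𝟙 (suc i ∣ℕ? suc n) * (suc i * N (suc i))))
             (trans (∑-* q xs _) (cong (q *_) (sym (total-degree n (ℕₚ.n≤1+n n))))) ⟩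
      q * (n * q ^ n) + ∑ xs (λ i → 𝟙 (suc i ∣ℕ? suc n) * (suc i * N (suc i))) ∎)
      where
      open ≡-Reasoning
      open Weight (suc n)
      xs = upTo (suc n)
      lemma : ∀ q n x → q * (n * x) + q * x ≡ suc n * (q * x)
      lemma = solve-∀
      split : ∀ i → N (suc i) * ∑ xs (λ j → suc i * #multiples (suc n) (suc j * suc i)) ≡
        q * (N (suc i) * ∑ xs λ j → suc i * #multiples n (suc j * suc i))
          + 𝟙 (suc i ∣ℕ? suc n) * (suc i * N (suc i))
      split i = begin
        N (suc i) * ∑ xs (λ j → suc i * #multiples (suc n) (suc j * suc i))
          ≡⟨ cong (N (suc i) *_) (trans (∑-* (suc i) xs _) (cong (suc i *_)
               (trans (∑-cong xs λ {j} _ → #multiples-suc n (suc j * suc i)) 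
               (∑-+ xs (λ j → q * #multiples n (suc j * suc i)) (λ j → 𝟙 (suc j * suc i ℕ.≟ suc n)))))) ⟩
        N (suc i) * (suc i * (∑ xs (λ j → q * #multiples n (suc j * suc i))
          + ∑ xs (λ j → 𝟙 (suc j * suc i ℕ.≟ suc n))))
          ≡⟨ cong₂ (λ x y → N (suc i) * (suc i * (x + y))) (∑-* q xs _) (∑-codivisor n i) ⟩
        N (suc i) * (suc i * (q * A + 𝟙 (suc i ∣ℕ? suc n)))
          ≡⟨ lemma′ (N (suc i)) (suc i) q A (𝟙 (suc i ∣ℕ? suc n)) ⟩
        q * (N (suc i) * (suc i * A)) + 𝟙 (suc i ∣ℕ? suc n) * (suc i * N (suc i))
          ≡⟨ cong (λ x → q * (N (suc i) * x) + 𝟙 (suc i ∣ℕ? suc n) * (suc i * N (suc i))) (∑-* (suc i) xs _) ⟨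
        q * (N (suc i) * ∑ xs λ j → suc i * #multiples n (suc j * suc i))
          + 𝟙 (suc i ∣ℕ? suc n) * (suc i * N (suc i)) ∎
        where
        A = ∑ xs λ j → #multiples n (suc j * suc i)
        lemma′ : ∀ m d q a b → m * (d * (q * a + b)) ≡ q * (m * (d * a)) + b * (d * m)
        lemma′ = solve-∀

-- Elementary inequalities

-- With s = a + b this is (1 - b/s)^n ≥ 1 - n b/s, multiplied by s^(n+1).
bernoulli : ∀ a b n → (a + b) ^ n * (a + b) ≤ (a + b) * a ^ n + n * b * (a + b) ^ n
bernoulli a b zero    = ℕₚ.≤-reflexive (lemma (a + b))
  where
  lemma : ∀ s → 1 * s ≡ s * 1 + 0
  lemma = solve-∀
bernoulli a b (suc n) = begin
  s * s ^ n * s                                      ≡⟨ ℕₚ.*-assoc s (s ^ n) s ⟩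
  s * (s ^ n * s)                                    ≤⟨ ℕₚ.*-monoʳ-≤ s (bernoulli a b n) ⟩
  s * (s * a ^ n + n * b * s ^ n)                    ≡⟨ lemma₁ a b n (a ^ n) (s ^ n) ⟩
  s * (a * a ^ n) + n * b * (s * s ^ n) + b * s * a ^ n
    ≤⟨ ℕₚ.+-monoʳ-≤ (s * (a * a ^ n) + n * b * (s * s ^ n))
         (ℕₚ.*-monoʳ-≤ (b * s) (ℕₚ.^-monoˡ-≤ n (ℕₚ.m≤m+n a b))) ⟩
  s * (a * a ^ n) + n * b * (s * s ^ n) + b * s * s ^ n
    ≡⟨ lemma₂ a b s n (a ^ n) (s ^ n) ⟩
  s * (a * a ^ n) + suc n * b * (s * s ^ n)          ∎
  where
  open ℕₚ.≤-Reasoning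
  s = a + b
  lemma₁ : ∀ a b n x y → (a + b) * ((a + b) * x + n * b * y) ≡
    (a + b) * (a * x) + n * b * ((a + b) * y) + b * (a + b) * x
  lemma₁ = solve-∀
  lemma₂ : ∀ a b s n x y → s * (a * x) + n * b * (s * y) + b * s * y ≡ s * (a * x) + suc n * b * (s * y)
  lemma₂ = solve-∀

-- By Bernoulli (a/s)^r ≥ 1 - r b/s ≥ 1/2 for s = a + b. So an additive error b is removed from an
-- r-th power at the cost of a factor 2.
power-half : ∀ A a b r → 0 < A → A ≤ a + b → 2 * (r * b) ≤ A → A ^ r ≤ 2 * a ^ r
power-half A a b r 0<A A≤s 2rb≤A = ℕₚ.≤-trans (ℕₚ.^-monoˡ-≤ r A≤s)
  (ℕₚ.*-cancelˡ-≤ s {{>-nonZero (ℕₚ.<-≤-trans 0<A A≤s)}}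
    (ℕₚ.+-cancelˡ-≤ (s * s ^ r) _ _ (begin
      s * s ^ r + s * s ^ r                     ≡⟨ lemma₁ s (s ^ r) ⟩
      2 * (s ^ r * s)                           ≤⟨ ℕₚ.*-monoʳ-≤ 2 (bernoulli a b r) ⟩
      2 * (s * a ^ r + r * b * s ^ r)           ≡⟨ lemma₂ s r b (a ^ r) (s ^ r) ⟩
      2 * (r * b) * s ^ r + s * (2 * a ^ r)     ≤⟨ ℕₚ.+-monoˡ-≤ _ (ℕₚ.*-monoˡ-≤ (s ^ r) (ℕₚ.≤-trans 2rb≤A A≤s)) ⟩
      s * s ^ r + s * (2 * a ^ r)               ∎)))
  where
  open ℕₚ.≤-Reasoning
  s = a + b
  lemma₁ : ∀ s x → s * x + s * x ≡ 2 * (x * s)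
  lemma₁ = solve-∀
  lemma₂ : ∀ s r b x y → 2 * (s * x + r * b * y) ≡ 2 * (r * b) * y + s * (2 * x)
  lemma₂ = solve-∀

-- This is (1 + 1/u)^k ≥ 1 + k/u, multiplied by u^(k+1).
bernoulli-suc : ∀ u k → u ^ k * (u + k) ≤ u * suc u ^ k
bernoulli-suc u zero    = ℕₚ.≤-reflexive (lemma u)
  where
  lemma : ∀ u → 1 * (u + 0) ≡ u * 1
  lemma = solve-∀
bernoulli-suc u (suc k) = begin
  u * u ^ k * (u + suc k)                    ≤⟨ ℕₚ.m≤m+n _ (u ^ k * k) ⟩
  u * u ^ k * (u + suc k) + u ^ k * k        ≡⟨ lemma₁ u k (u ^ k) ⟩
  suc u * (u ^ k * (u + k))                  ≤⟨ ℕₚ.*-monoʳ-≤ (suc u) (bernoulli-suc u k) ⟩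
  suc u * (u * suc u ^ k)                    ≡⟨ lemma₂ u (suc u ^ k) ⟩
  u * (suc u * suc u ^ k)                    ∎
  where
  open ℕₚ.≤-Reasoning
  lemma₁ : ∀ u k x → u * x * (u + suc k) + x * k ≡ suc u * (x * (u + k))
  lemma₁ = solve-∀
  lemma₂ : ∀ u x → suc u * (u * x) ≡ u * (suc u * x)
  lemma₂ = solve-∀

^-distrib-* : ∀ a b n → (a * b) ^ n ≡ a ^ n * b ^ n
^-distrib-* a b zero    = refl
^-distrib-* a b (suc n) = trans (cong (a * b *_) (^-distrib-* a b n)) (lemma a b (a ^ n) (b ^ n))
  where
  lemma : ∀ a b x y → a * b * (x * y) ≡ a * x * (b * y)
  lemma = solve-∀

-- (1 + 1/n)^(n+1) is at most 4, because it is decreasing and equals 4 at n = 1.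
[1+n]^[1+n]≤4*n^[1+n] : ∀ n → 1 ≤ n → suc n ^ suc n ≤ 4 * n ^ suc n
[1+n]^[1+n]≤4*n^[1+n] (suc zero)      _ = ℕₚ.≤-refl
[1+n]^[1+n]≤4*n^[1+n] (suc n@(suc _)) _ =
  ℕₚ.*-cancelˡ-≤ (n ^ suc n) {{ℕₚ.m^n≢0 n (suc n)}} (begin
    n ^ suc n * (suc (suc n) * suc (suc n) ^ suc n)
      ≡⟨ lemma₁ n (n ^ suc n) (suc (suc n) ^ suc n) ⟩
    suc (suc n) * (n ^ suc n * suc (suc n) ^ suc n)
      ≡⟨ cong (suc (suc n) *_) (^-distrib-* n (suc (suc n)) (suc n)) ⟨
    suc (suc n) * u ^ suc n
      ≤⟨ decreasing ⟩
    suc n * suc u ^ suc n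
      ≡⟨ cong (λ x → suc n * x ^ suc n) (suc-u n) ⟩
    suc n * (suc n * suc n) ^ suc n
      ≡⟨ cong (suc n *_) (^-distrib-* (suc n) (suc n) (suc n)) ⟩
    suc n * (suc n ^ suc n * suc n ^ suc n)
      ≤⟨ ℕₚ.*-monoʳ-≤ (suc n) (ℕₚ.*-monoˡ-≤ (suc n ^ suc n) ([1+n]^[1+n]≤4*n^[1+n] n (s≤s z≤n))) ⟩
    suc n * (4 * n ^ suc n * suc n ^ suc n)
      ≡⟨ lemma₂ n (n ^ suc n) (suc n ^ suc n) ⟩
    n ^ suc n * (4 * (suc n * suc n ^ suc n)) ∎)
  where
  open ℕₚ.≤-Reasoning
  u = n * suc (suc n)
  lemma₁ : ∀ n x y → x * (suc (suc n) * y) ≡ suc (suc n) * (x * y)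
  lemma₁ = solve-∀
  lemma₂ : ∀ n x y → suc n * (4 * x * y) ≡ x * (4 * (suc n * y))
  lemma₂ = solve-∀
  suc-u : ∀ n → suc (n * suc (suc n)) ≡ suc n * suc n
  suc-u = solve-∀
  lemma₃ : ∀ n x → n * suc (suc n) * (suc (suc n) * x) + x ≡ suc n * (x * (n * suc (suc n) + suc n))
  lemma₃ = solve-∀
  lemma₄ : ∀ n u x → suc n * (u * x) ≡ u * (suc n * x)
  lemma₄ = solve-∀
  -- As u + 1 = (n+1)², Bernoulli gives (1 + 1/u)^(n+1) ≥ 1 + (n+1)/u, and this is at least 1 +
  -- 1/(n+1) because (n+1)² ≥ u.
  decreasing : suc (suc n) * u ^ suc n ≤ suc n * suc u ^ suc n
  decreasing = ℕₚ.*-cancelˡ-≤ u (begin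
    u * (suc (suc n) * u ^ suc n)                      ≤⟨ ℕₚ.m≤m+n _ (u ^ suc n) ⟩
    u * (suc (suc n) * u ^ suc n) + u ^ suc n          ≡⟨ lemma₃ n (u ^ suc n) ⟩
    suc n * (u ^ suc n * (u + suc n))                  ≤⟨ ℕₚ.*-monoʳ-≤ (suc n) (bernoulli-suc u (suc n)) ⟩
    suc n * (u * suc u ^ suc n)                        ≡⟨ lemma₄ n u (suc u ^ suc n) ⟩
    u * (suc n * suc u ^ suc n)                        ∎)

-- Split (n+2)/n as (n+2)/(n+1) times (n+1)/n; the (n+1)-st power of each factor is at most 4.
[2+n]^[1+n]≤16*n^[1+n] : ∀ n → 1 ≤ n → suc (suc n) ^ suc n ≤ 16 * n ^ suc n
[2+n]^[1+n]≤16*n^[1+n] n 1≤n = ℕₚ.≤-trans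
  (ℕₚ.*-cancelˡ-≤ (suc (suc n)) (begin
    suc (suc n) ^ suc (suc n)              ≤⟨ [1+n]^[1+n]≤4*n^[1+n] (suc n) (s≤s z≤n) ⟩
    4 * (suc n * suc n ^ suc n)            ≤⟨ ℕₚ.*-monoʳ-≤ 4 (ℕₚ.*-monoˡ-≤ (suc n ^ suc n) (ℕₚ.n≤1+n (suc n))) ⟩
    4 * (suc (suc n) * suc n ^ suc n)      ≡⟨ lemma₁ (suc (suc n)) (suc n ^ suc n) ⟩
    suc (suc n) * (4 * suc n ^ suc n)      ∎))
  (begin
    4 * suc n ^ suc n       ≤⟨ ℕₚ.*-monoʳ-≤ 4 ([1+n]^[1+n]≤4*n^[1+n] n 1≤n) ⟩
    4 * (4 * n ^ suc n)     ≡⟨ ℕₚ.*-assoc 4 4 (n ^ suc n) ⟨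
    16 * n ^ suc n          ∎)
  where
  open ℕₚ.≤-Reasoning
  lemma₁ : ∀ a x → 4 * (a * x) ≡ a * (4 * x)
  lemma₁ = solve-∀

parity : ∀ n → ∃ λ t → n ≡ 2 * t ⊎ n ≡ suc (2 * t)
parity zero    = 0 , inj₁ refl
parity (suc n) with parity n
... | t , inj₁ e = t , inj₂ (cong suc e)
... | t , inj₂ e = suc t , inj₁ (trans (cong suc e) (lemma t))
  where
  lemma : ∀ t → suc (suc (2 * t)) ≡ 2 * suc t
  lemma = solve-∀

≤-by : ∀ {m n} k → n ≡ m + k → m ≤ n
≤-by {m} k e = subst (m ≤_) (sym e) (ℕₚ.m≤m+n m k)

-- h = ⌈n/2⌉ and e = ⌊n/2⌋ + 1, so that h = ⌊(n+1)/2⌋ and e = ⌈(n+1)/2⌉.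
growth-halves : ∀ (f : ℕ → ℕ) b k → (∀ n → f n ≤ f (suc n)) → f (suc (2 * k)) ≤ b ^ suc k →
  (∀ s → k ≤ s → f (suc (2 * suc s)) ≤ b * f (suc (2 * s))) →
  ∀ n → 2 * k ≤ n → ∃₂ λ h e → h + e ≡ suc n × n ≤ h + h × f n ≤ b ^ e
growth-halves f b k mono base step n 2k≤n = by-parity (parity n)
  where
  -- Two steps of n raise e by one and so allow one factor b. The numbers 2s and 2s + 1 share e = s
  -- + 1, so the odd ones decide and monotonicity of f covers the even ones.
  odd-bound : ∀ t → f (suc (2 * (t + k))) ≤ b ^ suc (t + k)
  odd-bound zero    = base
  odd-bound (suc t) = ℕₚ.≤-trans (step (t + k) (ℕₚ.m≤n+m k t)) (ℕₚ.*-monoʳ-≤ b (odd-bound t))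
  odd-bound≥ : ∀ s → 2 * k ≤ suc (2 * s) → f (suc (2 * s)) ≤ b ^ suc s
  odd-bound≥ s 2k≤ = subst (λ s → f (suc (2 * s)) ≤ b ^ suc s) (ℕₚ.m∸n+n≡m k≤s) (odd-bound (s ∸ k))
    where
    k≤s : k ≤ s
    k≤s = ℕₚ.≮⇒≥ λ s<k → ℕₚ.<⇒≱ (ℕₚ.≤-trans (ℕₚ.≤-reflexive (lemma s)) (ℕₚ.*-monoʳ-≤ 2 s<k)) 2k≤
      where
      lemma : ∀ s → suc (suc (2 * s)) ≡ 2 * suc s
      lemma = solve-∀
  by-parity : (∃ λ s → n ≡ 2 * s ⊎ n ≡ suc (2 * s)) → ∃₂ λ h e → h + e ≡ suc n × n ≤ h + h × f n ≤ b ^ e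
  by-parity (s , inj₁ refl) = s , suc s , lemma₁ s , ℕₚ.≤-reflexive (lemma₂ s) ,
    ℕₚ.≤-trans (mono (2 * s)) (odd-bound≥ s (ℕₚ.≤-trans 2k≤n (ℕₚ.n≤1+n (2 * s))))
    where
    lemma₁ : ∀ s → s + suc s ≡ suc (2 * s)
    lemma₁ = solve-∀
    lemma₂ : ∀ s → 2 * s ≡ s + s
    lemma₂ = solve-∀
  by-parity (s , inj₂ refl) = suc s , suc s , lemma₁ s , ≤-by 1 (lemma₂ s) , odd-bound≥ s 2k≤n
    where
    lemma₁ : ∀ s → suc s + suc s ≡ suc (suc (2 * s))
    lemma₁ = solve-∀
    lemma₂ : ∀ s → suc s + suc s ≡ suc (2 * s) + 1
    lemma₂ = solve-∀

3[2+n]² : ℕ → ℕ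
3[2+n]² n = 3 * (suc (suc n) * suc (suc n))

3[2+n]²-mono : ∀ n → 3[2+n]² n ≤ 3[2+n]² (suc n)
3[2+n]²-mono n = ℕₚ.*-monoʳ-≤ 3 (ℕₚ.*-mono-≤ (ℕₚ.n≤1+n (suc (suc n))) (ℕₚ.n≤1+n (suc (suc n))))

-- The quotient is ((2s+5)/(2s+3))², at most (7/5)² = 49/25 < 2 for s ≥ 1.
3[2+n]²-step : ∀ s → 1 ≤ s → 3[2+n]² (suc (2 * suc s)) ≤ 2 * 3[2+n]² (suc (2 * s))
3[2+n]²-step (suc x) _ = ≤-by (3 * (4 * x * x + 12 * x + 1)) (lemma x)
  where
  lemma : ∀ x → 2 * (3 * ((3 + 2 * suc x) * (3 + 2 * suc x))) ≡
    3 * ((3 + 2 * suc (suc x)) * (3 + 2 * suc (suc x))) + 3 * (4 * x * x + 12 * x + 1)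
  lemma = solve-∀

-- At n = 20, 21 the exponent e is 11 and 3 · 23² = 1587 ≤ 2^11. At n = 18, 19 it is 10, and already
-- 3 · 20² = 1200 exceeds 2^10.
square-halves₂ : ∀ n → 20 ≤ n → ∃₂ λ h e → h + e ≡ suc n × n ≤ h + h × 3[2+n]² n ≤ 2 ^ e
square-halves₂ = growth-halves 3[2+n]² 2 10 3[2+n]²-mono (toWitness {a? = 1587 ℕ.≤? 2048} _)
  λ s 10≤s → 3[2+n]²-step s (ℕₚ.≤-trans (s≤s z≤n) 10≤s)

-- The tightest case is n = 3, where 3 · 5² = 75 ≤ 9².
square-halves₉ : ∀ n → 2 ≤ n → ∃₂ λ h e → h + e ≡ suc n × n ≤ h + h × 3[2+n]² n ≤ 9 ^ e
square-halves₉ = growth-halves 3[2+n]² 9 1 3[2+n]²-mono (toWitness {a? = 75 ℕ.≤? 81} _)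
  λ s 1≤s → ℕₚ.≤-trans (3[2+n]²-step s 1≤s) (ℕₚ.*-monoˡ-≤ (3[2+n]² (suc (2 * s))) (ℕₚ.m≤m+n 2 7))

linear-halves : ∀ n → 12 ≤ n → ∃₂ λ h e → h + e ≡ suc n × n ≤ h + h × 4 * n ≤ 2 ^ e
linear-halves = growth-halves (4 *_) 2 6 (λ n → ℕₚ.*-monoʳ-≤ 4 (ℕₚ.n≤1+n n)) (toWitness {a? = 52 ℕ.≤? 128} _)
  λ s 6≤s → step s (ℕₚ.≤-trans (s≤s z≤n) 6≤s)
  where
  step : ∀ s → 1 ≤ s → 4 * suc (2 * suc s) ≤ 2 * (4 * suc (2 * s))
  step (suc x) _ = ≤-by (8 * x + 4) (lemma x)
    where
    lemma : ∀ x → 2 * (4 * suc (2 * suc x)) ≡ 4 * suc (2 * suc (suc x)) + (8 * x + 4)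
    lemma = solve-∀

-- This is 4 r for r = 2 n (n+2), the exponent of N_(n+1) in (2), in the shape in which
-- `power-lower` asks for it.
8n[2+n] : ℕ → ℕ
8n[2+n] n = 4 * (2 * (n * suc (suc n)))

quadratic-halves : ∀ n → 24 ≤ n → ∃₂ λ h e → h + e ≡ suc n × n ≤ h + h × 8n[2+n] n ≤ 2 ^ e
quadratic-halves = growth-halves 8n[2+n] 2 12
  (λ n → ℕₚ.*-monoʳ-≤ 4 (ℕₚ.*-monoʳ-≤ 2 (ℕₚ.*-mono-≤ (ℕₚ.n≤1+n n) (ℕₚ.n≤1+n (suc (suc n))))))
  (toWitness {a? = 5400 ℕ.≤? 8192} _)
  λ s 12≤s → step s (ℕₚ.≤-trans (s≤s (s≤s z≤n)) 12≤s)
  where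
  step : ∀ s → 2 ≤ s → 8n[2+n] (suc (2 * suc s)) ≤ 2 * 8n[2+n] (suc (2 * s))
  step (suc zero)    (s≤s ())
  step (suc (suc x)) _ = ≤-by (4 * (2 * (4 * x * x + 16 * x + 7))) (lemma x)
    where
    lemma : ∀ x → 2 * (4 * (2 * ((1 + 2 * suc (suc x)) * (3 + 2 * suc (suc x))))) ≡
      4 * (2 * ((1 + 2 * suc (suc (suc x))) * (3 + 2 * suc (suc (suc x))))) + 4 * (2 * (4 * x * x + 16 * x + 7))
    lemma = solve-∀

-- If Y ≤ X, then (c+1) X ≤ m X ≤ c X forces X = 0 and so Y = 0. The factor m gained from comparing
-- n with n + 1 thereby absorbs the accumulated constant c.
<-from-ratio : ∀ {m X Y} c → c < m → 0 < Y → m * X ≤ c * Y → X < Y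
<-from-ratio {m} {X} {Y} c c<m 0<Y mX≤cY = ℕₚ.≰⇒> λ Y≤X →
  ℕₚ.<⇒≱ 0<Y (ℕₚ.≤-trans Y≤X (ℕₚ.+-cancelʳ-≤ (c * X) X 0
    (ℕₚ.≤-trans (ℕₚ.*-monoˡ-≤ X c<m) (ℕₚ.≤-trans mX≤cY (ℕₚ.*-monoʳ-≤ c Y≤X)))))

0<factor : ∀ a b {Y} → 0 < a * (b * Y) → 0 < Y
0<factor a b {suc Y} _ = s≤s z≤n
0<factor a b {zero}  p = contradiction (trans (cong (a *_) (ℕₚ.*-zeroʳ b)) (ℕₚ.*-zeroʳ a)) (ℕₚ.<⇒≢ p ∘ sym)

-- Bounds for the number of irreducible polynomials

properDivisorSum : ℕ → ℕ → ℕ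
properDivisorSum q n = ∑ (upTo n) λ i → 𝟙 (suc i ∣ℕ? suc n) * q ^ suc i

module Estimates (q : ℕ) (1<q : 1 < q) (N : ℕ → ℕ)
  (gauss : ∀ n → q ^ suc n ≡ ∑ (upTo (suc n)) λ i → 𝟙 (suc i ∣ℕ? suc n) * (suc i * N (suc i))) where

  instance
    q≢0 : NonZero q
    q≢0 = >-nonZero (ℕₚ.<-trans (s≤s z≤n) 1<q)

  properDivisorDegrees : ℕ → ℕ
  properDivisorDegrees n = ∑ (upTo n) λ i → 𝟙 (suc i ∣ℕ? suc n) * (suc i * N (suc i))

  gauss-split : ∀ n → q ^ suc n ≡ properDivisorDegrees n + suc n * N (suc n)
  gauss-split n = trans (gauss n) (trans (∑-upTo-suc n λ i → 𝟙 (suc i ∣ℕ? suc n) * (suc i * N (suc i)))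
    (cong (properDivisorDegrees n +_)
      (trans (cong (_* (suc n * N (suc n))) (𝟙-yes (suc n ∣ℕ? suc n) ∣-refl)) (ℕₚ.*-identityˡ _))))

  upper : ∀ n → suc n * N (suc n) ≤ q ^ suc n
  upper n = subst (suc n * N (suc n) ≤_) (sym (gauss-split n)) (ℕₚ.m≤n+m _ (properDivisorDegrees n))

  -- For each proper divisor d the term d N_d is replaced by its upper bound q^d. The resulting
  -- divisor sum no longer involves N and evaluates for concrete q and n.
  lower : ∀ n → q ^ suc n ≤ properDivisorSum q n + suc n * N (suc n)
  lower n = ℕₚ.≤-trans (ℕₚ.≤-reflexive (gauss-split n)) (ℕₚ.+-monoˡ-≤ _
    (∑-mono (upTo n) λ {i} _ → ℕₚ.*-monoʳ-≤ (𝟙 (suc i ∣ℕ? suc n)) (upper i)))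

  -- Since q ≥ 2, twice the last power is at most the next one, which then counts double. The
  -- minimum in the exponent lets the induction on L continue past h, where the sum stops growing.
  geometric : ∀ h L → ∑ (upTo L) (λ i → 𝟙 (suc i ℕ.≤? h) * q ^ suc i) ≤ 2 * q ^ (L ⊓ h)
  geometric h zero    = z≤n
  geometric h (suc L) = ℕₚ.≤-trans (ℕₚ.≤-reflexive (∑-upTo-suc L _)) (by-cases (suc L ℕ.≤? h))
    where
    open ℕₚ.≤-Reasoning
    S = ∑ (upTo L) (λ i → 𝟙 (suc i ℕ.≤? h) * q ^ suc i)
    lemma : ∀ x → x + 1 * x ≡ 2 * x
    lemma = solve-∀
    by-cases : Dec (suc L ≤ h) → S + 𝟙 (suc L ℕ.≤? h) * q ^ suc L ≤ 2 * q ^ (suc L ⊓ h)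
    by-cases (yes L<h) = begin
      S + 𝟙 (suc L ℕ.≤? h) * q ^ suc L
        ≡⟨ cong (λ x → S + x * q ^ suc L) (𝟙-yes (suc L ℕ.≤? h) L<h) ⟩
      S + 1 * q ^ suc L
        ≤⟨ ℕₚ.+-monoˡ-≤ _ (geometric h L) ⟩
      2 * q ^ (L ⊓ h) + 1 * q ^ suc L
        ≤⟨ ℕₚ.+-monoˡ-≤ _ (ℕₚ.*-mono-≤ 1<q (ℕₚ.^-monoʳ-≤ q (ℕₚ.m⊓n≤m L h))) ⟩
      q ^ suc L + 1 * q ^ suc L
        ≡⟨ lemma (q ^ suc L) ⟩
      2 * q ^ suc L
        ≡⟨ cong (λ x → 2 * q ^ x) (ℕₚ.m≤n⇒m⊓n≡m L<h) ⟨
      2 * q ^ (suc L ⊓ h) ∎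
    by-cases (no L≮h) = begin
      S + 𝟙 (suc L ℕ.≤? h) * q ^ suc L
        ≡⟨ cong (λ x → S + x * q ^ suc L) (𝟙-no (suc L ℕ.≤? h) L≮h) ⟩
      S + 0
        ≡⟨ ℕₚ.+-identityʳ S ⟩
      S
        ≤⟨ geometric h L ⟩
      2 * q ^ (L ⊓ h)
        ≤⟨ ℕₚ.*-monoʳ-≤ 2 (ℕₚ.^-monoʳ-≤ q (ℕₚ.⊓-monoˡ-≤ h (ℕₚ.n≤1+n L))) ⟩
      2 * q ^ (suc L ⊓ h) ∎

  -- The cofactor of a proper divisor is at least 2, so a divisor above h would give n + 1 ≥ 2 (h +
  -- 1) > n + 1.
  properDivisor≤half : ∀ {d n h} → suc d < suc n → n ≤ h + h → suc d ∣ℕ suc n → suc d ≤ h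
  properDivisor≤half d<n _ (divides (suc zero) e) =
    contradiction (trans e (ℕₚ.*-identityˡ _)) (ℕₚ.<⇒≢ d<n ∘ sym)
  properDivisor≤half {d} {n} {h} _ n≤2h (divides (suc (suc k)) e) with suc d ℕ.≤? h
  ... | yes d<h = d<h
  ... | no d≮h = contradiction (begin
      suc (suc (h + h))                  ≡⟨ lemma h ⟩
      suc h + suc h                      ≤⟨ ℕₚ.+-mono-≤ (ℕₚ.≰⇒> d≮h) (ℕₚ.≰⇒> d≮h) ⟩
      suc d + suc d                      ≤⟨ ℕₚ.+-monoʳ-≤ (suc d) (ℕₚ.m≤m+n (suc d) (k * suc d)) ⟩
      suc d + (suc d + k * suc d)        ≡⟨ e ⟨
      suc n                              ≤⟨ s≤s n≤2h ⟩
      suc (h + h)                        ∎) ℕₚ.1+n≰n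
    where
    open ℕₚ.≤-Reasoning
    lemma : ∀ h → suc (suc (h + h)) ≡ suc h + suc h
    lemma = solve-∀

  lower-half : ∀ n h → n ≤ h + h → q ^ suc n ≤ suc n * N (suc n) + 2 * q ^ h
  lower-half n h n≤2h = begin
    q ^ suc n
      ≤⟨ lower n ⟩
    properDivisorSum q n + suc n * N (suc n)
      ≤⟨ ℕₚ.+-monoˡ-≤ _ (∑-mono (upTo n) λ {i} i∈ → ℕₚ.*-monoˡ-≤ (q ^ suc i) (indicator≤ i (∈-upTo⁻ i∈))) ⟩
    ∑ (upTo n) (λ i → 𝟙 (suc i ℕ.≤? h) * q ^ suc i) + suc n * N (suc n)
      ≤⟨ ℕₚ.+-monoˡ-≤ _ (ℕₚ.≤-trans (geometric h n) (ℕₚ.*-monoʳ-≤ 2 (ℕₚ.^-monoʳ-≤ q (ℕₚ.m⊓n≤n n h)))) ⟩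
    2 * q ^ h + suc n * N (suc n)
      ≡⟨ ℕₚ.+-comm (2 * q ^ h) _ ⟩
    suc n * N (suc n) + 2 * q ^ h ∎
    where
    open ℕₚ.≤-Reasoning
    indicator≤ : ∀ i → i < n → 𝟙 (suc i ∣ℕ? suc n) ≤ 𝟙 (suc i ℕ.≤? h)
    indicator≤ i i<n = by-cases (suc i ∣ℕ? suc n)
      where
      by-cases : Dec (suc i ∣ℕ suc n) → 𝟙 (suc i ∣ℕ? suc n) ≤ 𝟙 (suc i ℕ.≤? h)
      by-cases (no i∤n) = ℕₚ.≤-trans (ℕₚ.≤-reflexive (𝟙-no (suc i ∣ℕ? suc n) i∤n)) z≤n
      by-cases (yes i∣n) = ℕₚ.≤-reflexive (trans (𝟙-yes (suc i ∣ℕ? suc n) i∣n)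
        (sym (𝟙-yes (suc i ℕ.≤? h) (properDivisor≤half (s≤s i<n) n≤2h i∣n))))

  -- Increasing quotients of consecutive counts

  LogConvexAt : ℕ → Set
  LogConvexAt n = N (suc n) * N (suc n) < N (suc (suc n)) * N n

  -- Multiplying by (n+1)(n+3)(n+2)² turns each N_m into m N_m, for which bounds are known. The
  -- margin for their errors is (n+2)² - (n+1)(n+3) = 1.
  log-convex : ∀ n {A C B} →
    A ≤ suc n * N (suc n) → suc (suc n) * N (suc (suc n)) ≤ C → B ≤ suc (suc (suc n)) * N (suc (suc (suc n))) →
    suc n * suc (suc (suc n)) * (C * C) < suc (suc n) * suc (suc n) * (A * B) →
    LogConvexAt (suc n)
  log-convex n {A} {C} {B} A≤ ≤C B≤ hyp = ℕₚ.*-cancelˡ-< k _ _ (begin-strict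
    k * (N₂ * N₂)                               ≡⟨ lemma₁ n N₂ ⟩
    suc n * suc (suc (suc n)) * (suc (suc n) * N₂ * (suc (suc n) * N₂))
      ≤⟨ ℕₚ.*-monoʳ-≤ (suc n * suc (suc (suc n))) (ℕₚ.*-mono-≤ ≤C ≤C) ⟩
    suc n * suc (suc (suc n)) * (C * C)         <⟨ hyp ⟩
    suc (suc n) * suc (suc n) * (A * B)
      ≤⟨ ℕₚ.*-monoʳ-≤ (suc (suc n) * suc (suc n)) (ℕₚ.*-mono-≤ A≤ B≤) ⟩
    suc (suc n) * suc (suc n) * (suc n * N₁ * (suc (suc (suc n)) * N₃))
      ≡⟨ lemma₂ n N₁ N₃ ⟩
    k * (N₃ * N₁)                               ∎)
    where
    open ℕₚ.≤-Reasoning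
    N₁ = N (suc n)
    N₂ = N (suc (suc n))
    N₃ = N (suc (suc (suc n)))
    k = suc n * suc (suc (suc n)) * (suc (suc n) * suc (suc n))
    lemma₁ : ∀ n x → suc n * suc (suc (suc n)) * (suc (suc n) * suc (suc n)) * (x * x) ≡
      suc n * suc (suc (suc n)) * (suc (suc n) * x * (suc (suc n) * x))
    lemma₁ = solve-∀
    lemma₂ : ∀ n x y → suc (suc n) * suc (suc n) * (suc n * x * (suc (suc (suc n)) * y)) ≡
      suc n * suc (suc (suc n)) * (suc (suc n) * suc (suc n)) * (y * x)
    lemma₂ = solve-∀

  -- With k = (n+1)² and Y = q^e this is (k − 1) q Y² < k (Y − 2)(qY − 2).
  product-bound : ∀ p y z → 2 + z ≡ q * (2 + y) → 3 * suc p ≤ 2 + y →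
    p * (q * ((2 + y) * (2 + y))) < suc p * (y * z)
  product-bound p y z z≡ 3k≤Y = ℕₚ.+-cancelʳ-< (suc p * t) _ _ (begin-strict
    p * W + suc p * t            <⟨ ℕₚ.+-monoʳ-< (p * W) kt<W ⟩
    p * W + W                    ≡⟨ ℕₚ.+-comm (p * W) W ⟩
    suc p * W                    ≡⟨ cong (suc p *_) W≡ ⟩
    suc p * (y * z + t)          ≡⟨ ℕₚ.*-distribˡ-+ (suc p) (y * z) t ⟩
    suc p * (y * z) + suc p * t  ∎)
    where
    open ℕₚ.≤-Reasoning
    W = q * ((2 + y) * (2 + y))
    t = 2 * y + 2 * z + 4
    lemma₁ : ∀ y z → (2 + z) * (2 + y) ≡ y * z + (2 * y + 2 * z + 4)
    lemma₁ = solve-∀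
    lemma₂ : ∀ y z → 2 * y + 2 * z + 4 + 4 ≡ 2 * (2 + y) + 2 * (2 + z)
    lemma₂ = solve-∀
    lemma₃ : ∀ q y → q * (2 + y) + 2 * (q * (2 + y)) ≡ 3 * (q * (2 + y))
    lemma₃ = solve-∀
    lemma₄ : ∀ p x → suc p * (3 * x) ≡ 3 * suc p * x
    lemma₄ = solve-∀
    lemma₅ : ∀ q y → (2 + y) * (q * (2 + y)) ≡ q * ((2 + y) * (2 + y))
    lemma₅ = solve-∀
    W≡ : W ≡ y * z + t
    W≡ = trans (sym (ℕₚ.*-assoc q (2 + y) (2 + y))) (trans (cong (_* (2 + y)) (sym z≡)) (lemma₁ y z))
    kt<W : suc p * t < W
    kt<W = begin-strict
      suc p * t                              <⟨ ℕₚ.*-monoʳ-< (suc p) (ℕₚ.m<m+n t (s≤s z≤n)) ⟩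
      suc p * (t + 4)                        ≡⟨ cong (suc p *_) (lemma₂ y z) ⟩
      suc p * (2 * (2 + y) + 2 * (2 + z))    ≡⟨ cong (λ x → suc p * (2 * (2 + y) + 2 * x)) z≡ ⟩
      suc p * (2 * (2 + y) + 2 * (q * (2 + y)))
        ≤⟨ ℕₚ.*-monoʳ-≤ (suc p) (ℕₚ.+-monoˡ-≤ _ (ℕₚ.*-monoˡ-≤ (2 + y) 1<q)) ⟩
      suc p * (q * (2 + y) + 2 * (q * (2 + y)))  ≡⟨ cong (suc p *_) (lemma₃ q y) ⟩
      suc p * (3 * (q * (2 + y)))                ≡⟨ lemma₄ p (q * (2 + y)) ⟩
      3 * suc p * (q * (2 + y))                  ≤⟨ ℕₚ.*-monoˡ-≤ (q * (2 + y)) 3k≤Y ⟩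
      (2 + y) * (q * (2 + y))                    ≡⟨ lemma₅ q y ⟩
      W                                          ∎

  -- With X = q^h and Y = q^e the three bounds are X (Y - 2), q X Y and q X (q Y - 2): two steps in
  -- the degree raise h by one, so the last error is 2 q X. A common factor q X² leaves
  -- `product-bound`.
  log-convex-large : ∀ n h e → h + e ≡ suc n → n ≤ h + h → 3 * (suc (suc n) * suc (suc n)) ≤ q ^ e →
    LogConvexAt (suc n)
  log-convex-large n h e h+e≡n n≤2h 3k≤Y = log-convex n {X * y} {q * (X * Y)} {q * X * z}
    (ℕₚ.+-cancelʳ-≤ (2 * X) _ _ (begin
      X * y + 2 * X                             ≡⟨ lemma₁ X y ⟩
      X * (2 + y)                               ≡⟨ cong (X *_) 2+y≡Y ⟩
      X * Y                                     ≡⟨ XY≡ ⟩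
      q ^ suc n                                 ≤⟨ lower-half n h n≤2h ⟩
      suc n * N (suc n) + 2 * X                 ∎))
    (begin
      suc (suc n) * N (suc (suc n))             ≤⟨ upper (suc n) ⟩
      q * q ^ suc n                             ≡⟨ cong (q *_) XY≡ ⟨
      q * (X * Y)                               ∎)
    (ℕₚ.+-cancelʳ-≤ (2 * (q * X)) _ _ (begin
      q * X * z + 2 * (q * X)                   ≡⟨ lemma₁ (q * X) z ⟩
      q * X * (2 + z)                           ≡⟨ cong (q * X *_) 2+z≡qY ⟩
      q * X * (q * Y)                           ≡⟨ lemma₂ q X Y ⟩
      q * (q * (X * Y))                         ≡⟨ cong (λ x → q * (q * x)) XY≡ ⟩
      q ^ suc (suc (suc n))                     ≤⟨ lower-half (suc (suc n)) (suc h) n+2≤2h+2 ⟩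
      suc (suc (suc n)) * N (suc (suc (suc n))) + 2 * (q * X)  ∎))
    (begin-strict
      p * (q * (X * Y) * (q * (X * Y)))         ≡⟨ lemma₃ p q X Y ⟩
      q * (X * X) * (p * (q * (Y * Y)))         <⟨ ℕₚ.*-monoʳ-< (q * (X * X)) {{qXX≢0}} main ⟩
      q * (X * X) * (suc p * (y * z))           ≡⟨ cong (λ k → q * (X * X) * (k * (y * z))) (suc-p n) ⟩
      q * (X * X) * (suc (suc n) * suc (suc n) * (y * z))
        ≡⟨ lemma₄ q X (suc (suc n) * suc (suc n)) y z ⟩
      suc (suc n) * suc (suc n) * (X * y * (q * X * z)) ∎)
    where
    open ℕₚ.≤-Reasoning
    X = q ^ h
    Y = q ^ e
    y = Y ∸ 2
    z = q * Y ∸ 2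
    p = suc n * suc (suc (suc n))
    suc-p : ∀ n → suc (suc n * suc (suc (suc n))) ≡ suc (suc n) * suc (suc n)
    suc-p = solve-∀
    2≤Y : 2 ≤ Y
    2≤Y = ℕₚ.≤-trans (s≤s (s≤s z≤n)) 3k≤Y
    2+y≡Y : 2 + y ≡ Y
    2+y≡Y = ℕₚ.m+[n∸m]≡n 2≤Y
    2+z≡qY : 2 + z ≡ q * Y
    2+z≡qY = ℕₚ.m+[n∸m]≡n (ℕₚ.≤-trans 2≤Y (ℕₚ.m≤n*m Y q))
    XY≡ : X * Y ≡ q ^ suc n
    XY≡ = trans (sym (ℕₚ.^-distribˡ-+-* q h e)) (cong (q ^_) h+e≡n)
    n+2≤2h+2 : suc (suc n) ≤ suc h + suc h
    n+2≤2h+2 = ℕₚ.≤-trans (s≤s (s≤s n≤2h)) (ℕₚ.≤-reflexive (cong suc (sym (ℕₚ.+-suc h h))))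
    qXX≢0 : NonZero (q * (X * X))
    qXX≢0 = ℕₚ.m*n≢0 q (X * X) {{q≢0}} {{ℕₚ.m*n≢0 X X {{ℕₚ.m^n≢0 q h}} {{ℕₚ.m^n≢0 q h}}}}
    main : p * (q * (Y * Y)) < suc p * (y * z)
    main = subst (λ Y → p * (q * (Y * Y)) < suc p * (y * z)) 2+y≡Y
      (product-bound p y z (trans 2+z≡qY (cong (q *_) (sym 2+y≡Y)))
        (subst₂ (λ k Y → 3 * k ≤ Y) (sym (suc-p n)) (sym 2+y≡Y) 3k≤Y))
    lemma₁ : ∀ x y → x * y + 2 * x ≡ x * (2 + y)
    lemma₁ = solve-∀
    lemma₂ : ∀ q x y → q * x * (q * y) ≡ q * (q * (x * y))
    lemma₂ = solve-∀
    lemma₃ : ∀ p q x y → p * (q * (x * y) * (q * (x * y))) ≡ q * (x * x) * (p * (q * (y * y)))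
    lemma₃ = solve-∀
    lemma₄ : ∀ q x k y z → q * (x * x) * (k * (y * z)) ≡ k * (x * y * (q * x * z))
    lemma₄ = solve-∀

  -- The crude divisor bound is not sufficient for q = 2 and n = 19, 20.
  log-convex₂-19 : q ≡ 2 → LogConvexAt 19
  log-convex₂-19 refl = log-convex 18 {524286} {1048576} {2097014}
    (ℕₚ.+-cancelˡ-≤ 2 524286 (19 * N 19) (lower 18))
    (upper 19)
    (ℕₚ.+-cancelˡ-≤ 138 2097014 (21 * N 21) (lower 20))
    (toWitness {a? = 19 * 21 * (1048576 * 1048576) ℕ.<? 20 * 20 * (524286 * 2097014)} _)

  -- The amounts subtracted from powers of 2 are sums of 2^d over proper divisors: 1078 = 2 + 4 + 16
  -- + 32 + 1024 for 20 and 2054 = 2 + 4 + 2048 for 22. In `log-convex₂-19` they are 2 for the prime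
  -- 19 and 138 = 2 + 8 + 128 for 21.
  log-convex₂-20 : q ≡ 2 → LogConvexAt 20
  log-convex₂-20 refl = log-convex 19 {1047498} {2097152} {4192250}
    (ℕₚ.+-cancelˡ-≤ 1078 1047498 (20 * N 20) (lower 19))
    (upper 20)
    (ℕₚ.+-cancelˡ-≤ 2054 4192250 (22 * N 22) (lower 21))
    (toWitness {a? = 20 * 22 * (2097152 * 2097152) ℕ.<? 21 * 21 * (1047498 * 4192250)} _)

  log-convex≥3-19 : 3 ≤ q → LogConvexAt 19
  log-convex≥3-19 3≤q = log-convex-large 18 9 10 refl ℕₚ.≤-refl
    (ℕₚ.≤-trans (toWitness {a? = 3 * (20 * 20) ℕ.≤? 3 ^ 10} _) (ℕₚ.^-monoˡ-≤ 10 3≤q))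

  log-convex≥3-20 : 3 ≤ q → LogConvexAt 20
  log-convex≥3-20 3≤q = log-convex-large 19 10 10 refl (ℕₚ.n≤1+n 19)
    (ℕₚ.≤-trans (toWitness {a? = 3 * (21 * 21) ℕ.≤? 3 ^ 10} _) (ℕₚ.^-monoˡ-≤ 10 3≤q))

  log-convex≥21 : ∀ n → 20 ≤ n → LogConvexAt (suc n)
  log-convex≥21 n 20≤n with square-halves₂ n 20≤n
  ... | h , e , h+e≡n , n≤2h , sq≤ = log-convex-large n h e h+e≡n n≤2h
    (ℕₚ.≤-trans sq≤ (ℕₚ.^-monoˡ-≤ e 1<q))

  2≡q⊎3≤q : q ≡ 2 ⊎ 3 ≤ q
  2≡q⊎3≤q with ℕₚ.m≤n⇒m<n∨m≡n 1<q
  ... | inj₁ 2<q = inj₂ 2<q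
  ... | inj₂ 2≡q = inj₁ (sym 2≡q)

  log-convex≥19 : ∀ n → 19 ≤ n → LogConvexAt n
  log-convex≥19 (suc n) 19≤n with ℕₚ.m≤n⇒m<n∨m≡n 19≤n
  ... | inj₂ refl = [ log-convex₂-19 , log-convex≥3-19 ]′ 2≡q⊎3≤q
  ... | inj₁ 20≤n with ℕₚ.m≤n⇒m<n∨m≡n 20≤n
  ...   | inj₂ refl = [ log-convex₂-20 , log-convex≥3-20 ]′ 2≡q⊎3≤q
  ...   | inj₁ 21≤n = log-convex≥21 n (ℕ.s≤s⁻¹ 21≤n)

  module _ (9≤q : 9 ≤ q) where

    private
      -- Writing q = 9 + r turns q - 1 and q + 1 into 8 + r and 10 + r, so that polynomial
      -- identities in q involve no truncated subtraction.
      r : ℕ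
      r = q ∸ 9

      q≡ : q ≡ 9 + r
      q≡ = sym (ℕₚ.m+[n∸m]≡n 9≤q)

    N₁≡ : 1 * N 1 ≡ q
    N₁≡ = trans (sym (gauss-split 0)) (ℕₚ.*-identityʳ q)

    N₂≡ : 2 * N 2 ≡ q * (8 + r)
    N₂≡ = ℕₚ.+-cancelˡ-≡ q _ _ (trans (cong (_+ 2 * N 2) (sym N₁≡)) (trans (lemma₁ (N 1) (N 2))
      (trans (sym (gauss-split 1)) (trans (cong (λ x → q * (x * 1)) q≡) (lemma₂ q r)))))
      where
      lemma₁ : ∀ x y → 1 * x + 2 * y ≡ 1 * (1 * x) + 0 + 2 * y
      lemma₁ = solve-∀
      lemma₂ : ∀ q r → q * ((9 + r) * 1) ≡ q + q * (8 + r)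
      lemma₂ = solve-∀

    N₃≡ : 3 * N 3 ≡ q * ((8 + r) * (10 + r))
    N₃≡ = ℕₚ.+-cancelˡ-≡ q _ _ (trans (cong (_+ 3 * N 3) (sym N₁≡)) (trans (lemma₁ (N 1) (N 3))
      (trans (sym (gauss-split 2)) (trans (cong (λ x → q * (x * (x * 1))) q≡) (lemma₂ q r)))))
      where
      lemma₁ : ∀ x y → 1 * x + 3 * y ≡ 1 * (1 * x) + 0 + 3 * y
      lemma₁ = solve-∀
      lemma₂ : ∀ q r → q * ((9 + r) * ((9 + r) * 1)) ≡ q + q * ((8 + r) * (10 + r))
      lemma₂ = solve-∀

    N₄≡ : 4 * N 4 ≡ q * ((9 + r) * ((8 + r) * (10 + r)))
    N₄≡ = ℕₚ.+-cancelˡ-≡ (q + q * (8 + r)) _ _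
      (trans (cong₂ (λ x y → x + y + 4 * N 4) (sym N₁≡) (sym N₂≡)) (trans (lemma₁ (N 1) (N 2) (N 4))
      (trans (sym (gauss-split 3)) (trans (cong (λ x → q * (x * (x * (x * 1)))) q≡) (lemma₂ q r)))))
      where
      lemma₁ : ∀ x y z → 1 * x + 2 * y + 4 * z ≡ 1 * (1 * x) + (1 * (2 * y) + 0) + 4 * z
      lemma₁ = solve-∀
      lemma₂ : ∀ q r → q * ((9 + r) * ((9 + r) * ((9 + r) * 1))) ≡
        q + q * (8 + r) + q * ((9 + r) * ((8 + r) * (10 + r)))
      lemma₂ = solve-∀

    -- The growth bound for base 9 begins at n = 2 and hence yields convexity from index 3 on;
    -- indices 1 and 2 are settled by the exact values. At index 1 the difference is q² (q - 1)(q +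
    -- 7).
    log-convex≥1 : ∀ n → 1 ≤ n → LogConvexAt n
    log-convex≥1 1 _ = log-convex 0 (ℕₚ.≤-reflexive (sym N₁≡)) (ℕₚ.≤-reflexive N₂≡) (ℕₚ.≤-reflexive (sym N₃≡))
      (≤-by′ (lemma q r) (ℕₚ.m*n≢0 (q * q) ((8 + r) * (16 + r)) {{ℕₚ.m*n≢0 q q}}))
      where
      ≤-by′ : ∀ {m n k} → n ≡ m + k → NonZero k → m < n
      ≤-by′ {m} e k≢0 = subst (m <_) (sym e) (ℕₚ.m<m+n m (ℕ.>-nonZero⁻¹ _ {{k≢0}}))
      lemma : ∀ q r → 2 * 2 * (q * (q * ((8 + r) * (10 + r)))) ≡
        1 * 3 * (q * (8 + r) * (q * (8 + r))) + q * q * ((8 + r) * (16 + r))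
      lemma = solve-∀
    log-convex≥1 2 _ = log-convex 1 (ℕₚ.≤-reflexive (sym N₂≡)) (ℕₚ.≤-reflexive N₃≡) (ℕₚ.≤-reflexive (sym N₄≡))
      (begin-strict
        2 * 4 * (q * ((8 + r) * (10 + r)) * (q * ((8 + r) * (10 + r))))
          ≡⟨ lemma₁ q r ⟩
        W * (8 * (10 + r))
          -- Here 8 (q + 1) < 9 q is needed, that is q > 8. For q = 8 there is equality, N_3² = N_4
          -- N_2, so this index is where the bound 9 in (3) comes from.
          <⟨ ℕₚ.*-monoʳ-< W {{W≢0}} (subst (8 * (10 + r) <_) (sym (lemma₃ r)) (ℕₚ.m<m+n (8 * (10 + r)) (s≤s z≤n))) ⟩
        W * (9 * (9 + r))
          ≡⟨ lemma₂ q r ⟩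
        3 * 3 * (q * (8 + r) * (q * ((9 + r) * ((8 + r) * (10 + r))))) ∎)
      where
      open ℕₚ.≤-Reasoning
      W = q * q * ((8 + r) * (8 + r) * (10 + r))
      W≢0 : NonZero W
      W≢0 = ℕₚ.m*n≢0 (q * q) ((8 + r) * (8 + r) * (10 + r)) {{ℕₚ.m*n≢0 q q}}
      lemma₁ : ∀ q r → 2 * 4 * (q * ((8 + r) * (10 + r)) * (q * ((8 + r) * (10 + r)))) ≡
        q * q * ((8 + r) * (8 + r) * (10 + r)) * (8 * (10 + r))
      lemma₁ = solve-∀
      lemma₂ : ∀ q r → q * q * ((8 + r) * (8 + r) * (10 + r)) * (9 * (9 + r)) ≡
        3 * 3 * (q * (8 + r) * (q * ((9 + r) * ((8 + r) * (10 + r)))))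
      lemma₂ = solve-∀
      lemma₃ : ∀ r → 9 * (9 + r) ≡ 8 * (10 + r) + suc r
      lemma₃ = solve-∀
    log-convex≥1 (suc n@(suc (suc j))) _ with square-halves₉ n (ℕₚ.m≤m+n 2 j)
    ... | h , e , h+e≡n , n≤2h , sq≤ = log-convex-large n h e h+e≡n n≤2h
      (ℕₚ.≤-trans sq≤ (ℕₚ.^-monoˡ-≤ e 9≤q))

  -- Roots of the counts

  power-lower : ∀ n h e r → h + e ≡ suc n → n ≤ h + h → 4 * r ≤ q ^ e →
    (q ^ suc n) ^ r ≤ 2 * (suc n * N (suc n)) ^ r
  power-lower n h e r h+e≡n n≤2h 4r≤ = power-half (q ^ suc n) (suc n * N (suc n)) (2 * q ^ h) r
    (ℕₚ.m^n>0 q (suc n)) (lower-half n h n≤2h) (begin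
      -- The error 2 q^h relative to q^(n+1) is 2 / q^e, so its r-fold is at most one half as soon
      -- as 4 r ≤ q^e.
      2 * (r * (2 * q ^ h))    ≡⟨ lemma r (q ^ h) ⟩
      q ^ h * (4 * r)          ≤⟨ ℕₚ.*-monoʳ-≤ (q ^ h) 4r≤ ⟩
      q ^ h * q ^ e            ≡⟨ ℕₚ.^-distribˡ-+-* q h e ⟨
      q ^ (h + e)              ≡⟨ cong (q ^_) h+e≡n ⟩
      q ^ suc n                ∎)
    where
    open ℕₚ.≤-Reasoning
    lemma : ∀ r x → 2 * (r * (2 * x)) ≡ x * (4 * r)
    lemma = solve-∀

  power-lower≥13 : ∀ n → 13 ≤ n → (q ^ suc n) ^ n ≤ 2 * (suc n * N (suc n)) ^ n
  power-lower≥13 n 13≤n with linear-halves n (ℕₚ.<⇒≤ 13≤n)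
  ... | h , e , h+e≡n , n≤2h , 4n≤ = power-lower n h e n h+e≡n n≤2h (ℕₚ.≤-trans 4n≤ (ℕₚ.^-monoˡ-≤ e 1<q))

  power-lower≥25 : ∀ n → 25 ≤ n →
    (q ^ suc n) ^ (2 * (n * suc (suc n))) ≤ 2 * (suc n * N (suc n)) ^ (2 * (n * suc (suc n)))
  power-lower≥25 n 25≤n with quadratic-halves n (ℕₚ.<⇒≤ 25≤n)
  ... | h , e , h+e≡n , n≤2h , 4r≤ = power-lower n h e (2 * (n * suc (suc n))) h+e≡n n≤2h
    (ℕₚ.≤-trans 4r≤ (ℕₚ.^-monoˡ-≤ e 1<q))

  -- Bounding (n N_n)^(n+1) above and ((n+1) N_(n+1))^n below produces the same power of q. What
  -- remains is (n+1)^n / n^(n+1), which is (1 + 1/n)^(n+1) / (n+1) ≤ 4/(n+1); with the factor 2 of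
  -- `power-lower` this is 8/(n+1).
  root-increasing : ∀ n → 13 ≤ n → N n ^ suc n < N (suc n) ^ n
  root-increasing zero ()
  root-increasing n@(suc n′) 13≤n = <-from-ratio {m} 8 (ℕₚ.≤-trans (ℕₚ.≤-trans (ℕₚ.m≤m+n 9 4) 13≤n) (ℕₚ.n≤1+n n)) 0<Y
    (ℕₚ.*-cancelˡ-≤ (n ^ m) {{ℕₚ.m^n≢0 n m}} (begin
      n ^ m * (m * X)              ≡⟨ lemma₁ (n ^ m) m X ⟩
      m * (n ^ m * X)              ≡⟨ cong (m *_) (^-distrib-* n (N n) m) ⟨
      m * (n * N n) ^ m            ≤⟨ ℕₚ.*-monoʳ-≤ m (ℕₚ.^-monoˡ-≤ m (upper n′)) ⟩
      m * (q ^ n) ^ m              ≡⟨ cong (m *_) (trans (ℕₚ.^-*-assoc q n m)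
                                        (trans (cong (q ^_) (ℕₚ.*-comm n m)) (sym (ℕₚ.^-*-assoc q m n)))) ⟩
      m * (q ^ m) ^ n              ≤⟨ ℕₚ.*-monoʳ-≤ m main ⟩
      m * (2 * (m ^ n * Y))        ≡⟨ lemma₂ m (m ^ n) Y ⟩
      2 * (m ^ m * Y)              ≤⟨ ℕₚ.*-monoʳ-≤ 2 (ℕₚ.*-monoˡ-≤ Y ([1+n]^[1+n]≤4*n^[1+n] n (s≤s z≤n))) ⟩
      2 * (4 * n ^ m * Y)          ≡⟨ lemma₃ (n ^ m) Y ⟩
      n ^ m * (8 * Y)              ∎))
    where
    open ℕₚ.≤-Reasoning
    m = suc n
    X = N n ^ m
    Y = N m ^ n
    main : (q ^ m) ^ n ≤ 2 * (m ^ n * Y)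
    main = subst (λ x → (q ^ m) ^ n ≤ 2 * x) (^-distrib-* m (N m) n) (power-lower≥13 n 13≤n)
    0<Y : 0 < Y
    0<Y = 0<factor 2 (m ^ n) (ℕₚ.<-≤-trans (ℕₚ.m^n>0 (q ^ m) {{ℕₚ.m^n≢0 q m}} n) main)
    lemma₁ : ∀ a m x → a * (m * x) ≡ m * (a * x)
    lemma₁ = solve-∀
    lemma₂ : ∀ m a y → m * (2 * (a * y)) ≡ 2 * (m * a * y)
    lemma₂ = solve-∀
    lemma₃ : ∀ a y → 2 * (4 * a * y) ≡ a * (8 * y)
    lemma₃ = solve-∀

  -- Raising the inequality of quotients of roots to the power n(n+1)(n+2) gives these exponents.
  -- The powers of q again agree on both sides, so only the denominators n, n + 1, n + 2 and the
  -- factor 2 of `power-lower` matter.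
  root-log-concave : ∀ n → 25 ≤ n →
    N (suc (suc n)) ^ (n * suc n) * N n ^ (suc n * suc (suc n)) < N (suc n) ^ (2 * (n * suc (suc n)))
  root-log-concave zero ()
  root-log-concave n@(suc n′) 25≤n = <-from-ratio {m * m} 128 128<mm 0<Y
    (ℕₚ.*-cancelˡ-≤ K {{K≢0}} (begin
      K * (m * m * X)                            ≡⟨ lemma₁ (l ^ (n * m)) (n ^ (m * l)) (m * m) (N l ^ (n * m)) (N n ^ (m * l)) ⟩
      m * m * ((l ^ (n * m) * N l ^ (n * m)) * (n ^ (m * l) * N n ^ (m * l)))
        ≡⟨ cong₂ (λ x y → m * m * (x * y)) (^-distrib-* l (N l) (n * m)) (^-distrib-* n (N n) (m * l)) ⟨
      m * m * ((l * N l) ^ (n * m) * (n * N n) ^ (m * l))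
        ≤⟨ ℕₚ.*-monoʳ-≤ (m * m) (ℕₚ.*-mono-≤ (ℕₚ.^-monoˡ-≤ (n * m) (upper m)) (ℕₚ.^-monoˡ-≤ (m * l) (upper n′))) ⟩
      m * m * ((q ^ l) ^ (n * m) * (q ^ n) ^ (m * l))
        ≡⟨ cong (m * m *_) q-powers ⟩
      m * m * (q ^ m) ^ r
        ≤⟨ ℕₚ.*-monoʳ-≤ (m * m) main ⟩
      m * m * (2 * (m ^ r * Y))                  ≡⟨ lemma₂ (m * m) (m ^ r) Y ⟩
      2 * (m * m * m ^ r * Y)                    ≤⟨ ℕₚ.*-monoʳ-≤ 2 (ℕₚ.*-monoˡ-≤ Y mmm^r≤64K) ⟩
      2 * (64 * K * Y)                           ≡⟨ lemma₃ K Y ⟩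
      K * (128 * Y)                              ∎))
    where
    open ℕₚ.≤-Reasoning
    m = suc n
    l = suc (suc n)
    u = n * l
    r = 2 * (n * l)
    X = N l ^ (n * m) * N n ^ (m * l)
    Y = N m ^ r
    K = l ^ (n * m) * n ^ (m * l)
    K≢0 : NonZero K
    K≢0 = ℕₚ.m*n≢0 (l ^ (n * m)) (n ^ (m * l)) {{ℕₚ.m^n≢0 l (n * m)}} {{ℕₚ.m^n≢0 n (m * l)}}
    main : (q ^ m) ^ r ≤ 2 * (m ^ r * Y)
    main = subst (λ x → (q ^ m) ^ r ≤ 2 * x) (^-distrib-* m (N m) r) (power-lower≥25 n 25≤n)
    0<Y : 0 < Y
    0<Y = 0<factor 2 (m ^ r) (ℕₚ.<-≤-trans (ℕₚ.m^n>0 (q ^ m) {{ℕₚ.m^n≢0 q m}} r) main)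
    128<mm : 128 < m * m
    128<mm = ℕₚ.≤-trans (toWitness {a? = 129 ℕ.≤? 26 * 26} _) (ℕₚ.*-mono-≤ (s≤s 25≤n) (s≤s 25≤n))
    q-powers : (q ^ l) ^ (n * m) * (q ^ n) ^ (m * l) ≡ (q ^ m) ^ r
    q-powers = trans (cong₂ _*_ (ℕₚ.^-*-assoc q l (n * m)) (ℕₚ.^-*-assoc q n (m * l)))
      (trans (sym (ℕₚ.^-distribˡ-+-* q (l * (n * m)) (n * (m * l))))
        (trans (cong (q ^_) (exponents l m n)) (sym (ℕₚ.^-*-assoc q m r))))
      where
      exponents : ∀ l m n → l * (n * m) + n * (m * l) ≡ m * (2 * (n * l))
      exponents = solve-∀
    suc-u : suc u ≡ m * m
    suc-u = identity n
      where
      identity : ∀ n → suc (n * suc (suc n)) ≡ suc n * suc n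
      identity = solve-∀
    -- With u = n (n+2) and m² = u + 1 the left side is (u+1)^(u+1) ≤ 4 u^(u+1). Compared with K,
    -- the product n^(u+1) l^(u+1) has m factors l in place of n, which costs at most 16.
    mmm^r≤64K : m * m * m ^ r ≤ 64 * K
    mmm^r≤64K = begin
      m * m * m ^ r                              ≡⟨ cong (m * m *_) (trans (cong (m ^_) (lemma₄ u)) (trans (ℕₚ.^-distribˡ-+-* m u u) (sym (^-distrib-* m m u)))) ⟩
      (m * m) ^ suc u                            ≡⟨ cong (_^ suc u) suc-u ⟨
      suc u ^ suc u                              ≤⟨ [1+n]^[1+n]≤4*n^[1+n] u (s≤s z≤n) ⟩
      4 * u ^ suc u                              ≡⟨ cong (4 *_) (^-distrib-* n l (suc u)) ⟩
      4 * (n ^ suc u * l ^ suc u)                ≡⟨ cong (λ x → 4 * (n ^ suc u * x)) (trans (cong (l ^_) (lemma₅ n)) (ℕₚ.^-distribˡ-+-* l (n * m) m)) ⟩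
      4 * (n ^ suc u * (l ^ (n * m) * l ^ m))
        ≤⟨ ℕₚ.*-monoʳ-≤ 4 (ℕₚ.*-monoʳ-≤ (n ^ suc u) (ℕₚ.*-monoʳ-≤ (l ^ (n * m)) ([2+n]^[1+n]≤16*n^[1+n] n (s≤s z≤n)))) ⟩
      4 * (n ^ suc u * (l ^ (n * m) * (16 * n ^ m)))
        ≡⟨ lemma₆ (n ^ suc u) (l ^ (n * m)) (n ^ m) ⟩
      64 * (l ^ (n * m) * (n ^ suc u * n ^ m))
        ≡⟨ cong (λ x → 64 * (l ^ (n * m) * x)) (trans (sym (ℕₚ.^-distribˡ-+-* n (suc u) m)) (cong (n ^_) (lemma₇ n))) ⟩
      64 * K ∎
      where
      lemma₄ : ∀ u → 2 * u ≡ u + u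
      lemma₄ = solve-∀
      lemma₅ : ∀ n → suc (n * suc (suc n)) ≡ n * suc n + suc n
      lemma₅ = solve-∀
      lemma₆ : ∀ a b c → 4 * (a * (b * (16 * c))) ≡ 64 * (b * (a * c))
      lemma₆ = solve-∀
      lemma₇ : ∀ n → suc (n * suc (suc n)) + suc n ≡ suc n * suc (suc n)
      lemma₇ = solve-∀
    lemma₁ : ∀ a b m x y → a * b * (m * (x * y)) ≡ m * ((a * x) * (b * y))
    lemma₁ = solve-∀
    lemma₂ : ∀ m a y → m * (2 * (a * y)) ≡ 2 * (m * a * y)
    lemma₂ = solve-∀
    lemma₃ : ∀ k y → 2 * (64 * k * y) ≡ k * (128 * y)
    lemma₃ = solve-∀

-- The exponential threshold

ℕtoℚ-cancel-< : ∀ {m n} → ℕtoℚ m ℚ.< ℕtoℚ n → m < n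
ℕtoℚ-cancel-< {m} {n} (*<* p) = ℤₚ.drop‿+<+ (subst₂ ℤ._<_ (ℤₚ.*-identityʳ (ℤ.+ m)) (ℤₚ.*-identityʳ (ℤ.+ n)) p)

ℕtoℚ-cancel-≤ : ∀ {m n} → ℕtoℚ m ℚ.≤ ℕtoℚ n → m ≤ n
ℕtoℚ-cancel-≤ {m} {n} (*≤* p) = ℤₚ.drop‿+≤+ (subst₂ ℤ._≤_ (ℤₚ.*-identityʳ (ℤ.+ m)) (ℤₚ.*-identityʳ (ℤ.+ n)) p)

powQ-nonNeg : ∀ c .{{_ : ℚ.NonNegative c}} k → ℚ.NonNegative (powQ c k)
powQ-nonNeg c zero    = _
powQ-nonNeg c (suc k) = ℚₚ.nonNeg*nonNeg⇒nonNeg c (powQ c k) {{powQ-nonNeg c k}}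

powQ-mono : ∀ {b c} .{{_ : ℚ.NonNegative b}} → b ℚ.≤ c → ∀ k → powQ b k ℚ.≤ powQ c k
powQ-mono b≤c zero   = ℚₚ.≤-refl
powQ-mono {b} {{b≥0}} b≤c (suc k) = ℚₚ.*-mono-≤-nonNeg {r = powQ b k} {{b≥0}} {{powQ-nonNeg b k}} b≤c (powQ-mono b≤c k)

term-nonNeg : ∀ c .{{_ : ℚ.NonNegative c}} k → ℚ.NonNegative (powQ c k ℚ.* invFact k)
term-nonNeg c k = ℚₚ.nonNeg*nonNeg⇒nonNeg (powQ c k) {{powQ-nonNeg c k}} (invFact k)

expPartial-monoˡ : ∀ {b c} .{{_ : ℚ.NonNegative b}} → b ℚ.≤ c → ∀ M → expPartial b M ℚ.≤ expPartial c M
expPartial-monoˡ b≤c zero    = ℚₚ.≤-refl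
expPartial-monoˡ b≤c (suc M) = ℚₚ.+-mono-≤ (expPartial-monoˡ b≤c M)
  (ℚₚ.*-monoˡ-≤-nonNeg (invFact (suc M)) (powQ-mono b≤c (suc M)))

p≤p+q : ∀ p q .{{_ : ℚ.NonNegative q}} → p ℚ.≤ p ℚ.+ q
p≤p+q p q = ℚₚ.≤-trans (ℚₚ.p≤q+p p q) (ℚₚ.≤-reflexive (ℚₚ.+-comm q p))

expPartial-monoʳ : ∀ c .{{_ : ℚ.NonNegative c}} k j → expPartial c k ℚ.≤ expPartial c (j + k)
expPartial-monoʳ c k zero    = ℚₚ.≤-refl
expPartial-monoʳ c k (suc j) = ℚₚ.≤-trans (expPartial-monoʳ c k j)
  (p≤p+q _ (powQ c (suc (j + k)) ℚ.* invFact (suc (j + k))) {{term-nonNeg c (suc (j + k))}})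

-- The side condition 2c ≤ M + 2 of `ExpLess` forces M ≥ 4, so the partial sum contains the terms up
-- to j = 3. At c = 3 these add up to 13, and all later terms and the tail bound are nonnegative.
3≤c⇒13<x : ∀ {c} n → ℕtoℚ 3 ℚ.≤ c → ExpLess c (ℕtoℚ n) → 13 < n
3≤c⇒13<x {c} n 3≤c (M , 2c≤M+2 , exp<n) = ℕtoℚ-cancel-< (ℚₚ.≤-<-trans 13≤exp
  (ℚₚ.≤-<-trans (p≤p+q (expPartial c M) tail {{tail-nonNeg}}) exp<n))
  where
  c-nonNeg : ℚ.NonNegative c
  c-nonNeg = ℚₚ.nonNeg≤⇒nonNeg 3≤c
  tail = ℕtoℚ 2 ℚ.* (powQ c (suc M) ℚ.* invFact (suc M))
  tail-nonNeg : ℚ.NonNegative tail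
  tail-nonNeg = ℚₚ.nonNeg*nonNeg⇒nonNeg (ℕtoℚ 2) (powQ c (suc M) ℚ.* invFact (suc M)) {{term-nonNeg c {{c-nonNeg}} (suc M)}}
  3≤M : 3 ≤ M
  3≤M = ℕₚ.≤-trans (ℕₚ.n≤1+n 3) (ℕ.s≤s⁻¹ (ℕ.s≤s⁻¹ (ℕtoℚ-cancel-≤ {6}
    (ℚₚ.≤-trans (ℚₚ.*-monoʳ-≤-nonNeg (ℕtoℚ 2) 3≤c) 2c≤M+2))))
  13≤exp : ℕtoℚ 13 ℚ.≤ expPartial c M
  13≤exp = ℚₚ.≤-trans (toWitness {a? = ℕtoℚ 13 ℚₚ.≤? expPartial (ℕtoℚ 3) 3} _)
    (ℚₚ.≤-trans (expPartial-monoˡ 3≤c 3)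
      (subst (λ k → expPartial c 3 ℚ.≤ expPartial c k) (ℕₚ.m∸n+n≡m 3≤M) (expPartial-monoʳ c {{c-nonNeg}} 3 (M ∸ 3))))

-- `mkℚᵘ` stores the denominator minus one, so the fraction is (3d + 7)/d only for d ≥ 1; this is
-- where q ≥ 2 enters.
3≤threshold : ∀ q → 1 < q → ℕtoℚ 3 ℚ.≤ threshold q
3≤threshold q 1<q = *≤* (subst₂ ℤ._≤_ (ℤₚ.pos-* 3 (suc (d ∸ 1))) (ℤₚ.pos-* (3 * d + 7) 1)
  (ℤ.+≤+ (ℕₚ.≤-trans (ℕₚ.*-monoʳ-≤ 3 (ℕₚ.≤-reflexive (ℕₚ.m+[n∸m]≡n 1≤d)))
    (ℕₚ.≤-trans (ℕₚ.m≤m+n (3 * d) 7) (ℕₚ.≤-reflexive (sym (ℕₚ.*-identityʳ _)))))))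
  where
  d = (q ∸ 1) ^ 2
  1≤d : 1 ≤ d
  1≤d = ℕₚ.^-monoˡ-≤ 2 (ℕₚ.∸-monoˡ-≤ 1 1<q)

-- Roots and quotients of positive numbers are cleared: (1) is raised to the power n(n+1), (2) is
-- cross-multiplied and raised to the power n(n+1)(n+2), and (3) and (4) are cross-multiplied. In
-- (2) the bound 583500000000000 is 5.835 · 10^14.
theorem1p1 : (q : ℕ) → 1 < q → IsPrimePower q → (F : FiniteField q) →
    (N : ℕ → ℕ) → CountsIrreducibles F N →
    ((n : ℕ) → ExpLess (threshold q) (ℕtoℚ n) →
    N n ^ suc n < N (suc n) ^ n)
    × ((n : ℕ) → 583500000000000 ≤ n →
    N (suc (suc n)) ^ (n * suc n) * N n ^ (suc n * suc (suc n))
    < N (suc n) ^ (2 * (n * suc (suc n))))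
    × (9 ≤ q → (n : ℕ) → 1 ≤ n →
    N (suc n) * N (suc n) < N (suc (suc n)) * N n)
    × (q < 9 → (n : ℕ) → 19 ≤ n →
    N (suc n) * N (suc n) < N (suc (suc n)) * N n)
theorem1p1 q 1<q _ F N counts =
    (λ n exp<n → root-increasing n (ℕₚ.<⇒≤ (3≤c⇒13<x n (3≤threshold q 1<q) exp<n)))
  , (λ n n≥ → root-log-concave n (ℕₚ.≤-trans (toWitness {a? = 25 ℕ.≤? 583500000000000} _) n≥))
  , log-convex≥1
  , (λ _ → log-convex≥19)
  where
  open PolynomialCounting.Counting F N counts using (gauss)
  open Estimates q 1<q N gauss
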